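{- If $T\neq P_4$ is a tree of order $n>2$, then $PRC(T)\leq n-2$, with equality if and only if $T\in\{P_5,P_6,P_7,\mathcal{R}\}$, where $\mathcal{R}$ is the tree with vertex set $\{v_1,\dots,v_6\}$ and edge set $\{v_1v_2,\,v_1v_3,\,v_1v_4,\,v_3v_5,\,v_4v_6\}$.
   Context: All graphs are simple, finite and undirected; $P_n$ is the path on $n$ vertices. A set $S\subseteq V(G)$ is a dominating set if every vertex not in $S$ has a neighbor in $S$; $S$ is a perfect dominating set if every vertex in $V(G)\setminus S$ has exactly one neighbor in $S$. A perfect coalition in $G$ consists of two disjoint sets $V_1,V_2$ of vertices such that (i) neither $V_1$ nor $V_2$ is a dominating set of $G$; (ii) each vertex in $V(G)\setminus V_1$ has at most one neighbor in $V_1$, and each vertex in $V(G)\setminus V_2$ has at most one neighbor in $V_2$; (iii) $V_1\cup V_2$ is a perfect dominating set of $G$. A perfect coalition partition ($prc$-partition) of $G$ is a vertex partition $\pi=\{V_1,\dots,V_k\}$ such that each $V_i$ either is a singleton dominating set or forms a perfect coalition with some $V_j\in\pi$. $PRC(G)$ is the maximum cardinality of a $prc$-partition of $G$, with $PRC(G)=0$ if $G$ has no $prc$-partition. -}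

module Defs where

open import Data.Nat using (ℕ; zero; suc; _≤_; _<_; _∸_)
open import Data.Nat.Base using (_≡ᵇ_)
open import Data.Bool using (Bool; true; false; _∨_)
open import Data.Bool.Properties using (∨-comm)
open import Data.Fin using (Fin; zero; suc; toℕ; inject₁; fromℕ)
open import Data.Product using (Σ; ∃; ∃-syntax; _×_; _,_)
open import Data.Sum using (_⊎_)
open import Relation.Nullary using (¬_)
open import Relation.Binary.PropositionalEquality using (_≡_; _≢_; refl)
open import Function.Bundles using (_↔_; Inverse)

record Graph (n : ℕ) : Set where
  field
    adj        : Fin n → Fin n → Bool
    adj-sym    : ∀ u v → adj u v ≡ adj v u
    adj-irrefl : ∀ v → adj v v ≡ false
open Graph public

Adj : ∀ {n} → Graph n → Fin n → Fin n → Set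
Adj G u v = adj G u v ≡ true

VSet : ℕ → Set₁
VSet n = Fin n → Set

Connected : ∀ {n} → Graph n → Set
Connected {n} G = ∀ (u v : Fin n) → ∃[ m ] Σ (Fin (suc m) → Fin n) λ p →
  (p zero ≡ u) × (p (fromℕ m) ≡ v) × (∀ (i : Fin m) → Adj G (p (inject₁ i)) (p (suc i)))

HasCycle : ∀ {n} → Graph n → Set
HasCycle {n} G = ∃[ k ] Σ (Fin (suc (suc (suc k))) → Fin n) λ c →
  (∀ i j → c i ≡ c j → i ≡ j) ×
  (∀ (i : Fin (suc (suc k))) → Adj G (c (inject₁ i)) (c (suc i))) ×
  Adj G (c (fromℕ (suc (suc k)))) (c zero)

IsTree : ∀ {n} → Graph n → Set
IsTree G = Connected G × ¬ HasCycle G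

_≅_ : ∀ {n m} → Graph n → Graph m → Set
_≅_ {n} {m} G H = Σ (Fin n ↔ Fin m) λ f →
  ∀ u v → adj G u v ≡ adj H (Inverse.to f u) (Inverse.to f v)

private
  suc≢ᵇ : ∀ m → (suc m ≡ᵇ m) ≡ false
  suc≢ᵇ zero = refl
  suc≢ᵇ (suc m) = suc≢ᵇ m

  ∨-false : ∀ b → b ≡ false → (b ∨ b) ≡ false
  ∨-false .false refl = refl

Path : (n : ℕ) → Graph n
Path n = record
  { adj        = λ i j → (suc (toℕ i) ≡ᵇ toℕ j) ∨ (suc (toℕ j) ≡ᵇ toℕ i)
  ; adj-sym    = λ i j → ∨-comm (suc (toℕ i) ≡ᵇ toℕ j) (suc (toℕ j) ≡ᵇ toℕ i)
  ; adj-irrefl = λ i → ∨-false _ (suc≢ᵇ (toℕ i))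
  }

-- R : vertices v1..v6 encoded as 0..5; edges v1v2, v1v3, v1v4, v3v5, v4v6.
private
  R-edge : Fin 6 → Fin 6 → Bool
  R-edge zero (suc zero) = true
  R-edge zero (suc (suc zero)) = true
  R-edge zero (suc (suc (suc zero))) = true
  R-edge (suc (suc zero)) (suc (suc (suc (suc zero)))) = true
  R-edge (suc (suc (suc zero))) (suc (suc (suc (suc (suc zero))))) = true
  R-edge _ _ = false

  R-edge-irrefl : ∀ v → R-edge v v ≡ false
  R-edge-irrefl zero = refl
  R-edge-irrefl (suc zero) = refl
  R-edge-irrefl (suc (suc zero)) = refl
  R-edge-irrefl (suc (suc (suc zero))) = refl
  R-edge-irrefl (suc (suc (suc (suc zero)))) = refl
  R-edge-irrefl (suc (suc (suc (suc (suc zero))))) = refl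

R : Graph 6
R = record
  { adj        = λ i j → R-edge i j ∨ R-edge j i
  ; adj-sym    = λ i j → ∨-comm (R-edge i j) (R-edge j i)
  ; adj-irrefl = λ i → ∨-false _ (R-edge-irrefl i)
  }

Dominating : ∀ {n} → Graph n → VSet n → Set
Dominating {n} G S = ∀ (v : Fin n) → S v ⊎ (∃[ u ] (S u × Adj G v u))

AtMostOneNbr : ∀ {n} → Graph n → VSet n → Set
AtMostOneNbr {n} G S = ∀ (v : Fin n) → ¬ S v →
  ∀ u w → S u → S w → Adj G v u → Adj G v w → u ≡ w

PerfectDominating : ∀ {n} → Graph n → VSet n → Set
PerfectDominating G S = Dominating G S × AtMostOneNbr G S

_∪_ : ∀ {n} → VSet n → VSet n → VSet n
(S ∪ T) v = S v ⊎ T v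

PerfectCoalition : ∀ {n} → Graph n → VSet n → VSet n → Set
PerfectCoalition {n} G V₁ V₂ =
  (∀ (v : Fin n) → V₁ v → V₂ v → Data.Empty.⊥) ×
  ¬ Dominating G V₁ × ¬ Dominating G V₂ ×
  AtMostOneNbr G V₁ × AtMostOneNbr G V₂ ×
  PerfectDominating G (V₁ ∪ V₂)
  where import Data.Empty

-- Perfect coalition partitions. A partition into k (nonempty) classes is
-- represented by a surjective labelling c : Fin n → Fin k; the classes
-- are V_i = { v | c v ≡ i }.

Class : ∀ {n k} → (Fin n → Fin k) → Fin k → VSet n
Class c i v = c v ≡ i

IsPRCPartition : ∀ {n} → Graph n → (k : ℕ) → (Fin n → Fin k) → Set
IsPRCPartition {n} G k c =
  (∀ (i : Fin k) → ∃[ v ] c v ≡ i) ×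
  (∀ (i : Fin k) →
     (Dominating G (Class c i) × (∀ u v → c u ≡ i → c v ≡ i → u ≡ v))
     ⊎ (∃[ j ] PerfectCoalition G (Class c i) (Class c j)))

HasPRCPartition : ∀ {n} → Graph n → ℕ → Set
HasPRCPartition {n} G k = Σ (Fin n → Fin k) λ c → IsPRCPartition G k c

PRC : ∀ {n} → Graph n → ℕ → Set
PRC G p =
  (HasPRCPartition G p × (∀ k → HasPRCPartition G k → k ≤ p))
  ⊎ ((p ≡ 0) × (∀ k → ¬ HasPRCPartition G k))

{-# OPTIONS --safe #-}
-- A star has no perfect coalition partition: the class of the centre is dominating, so it would have
-- to be a singleton, and two further disjoint classes would give the centre two neighbours in their
-- union. Any other tree has two leaves l, l′ with distinct supports s, s′. In a partition into
-- k ≥ n - 2 classes, a singleton class {x} with x outside {l, s, l′, s′} needs a partner meeting both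
-- {l, s} and {l′, s′}, and at most two classes have more than one element. A class Y cannot have more
-- than max(2, |Y|) singleton partners, since they all lie in the closed neighbourhood of a vertex not
-- dominated by Y. Hence n ≤ 8, and the finitely many trees that remain, enumerated up to isomorphism
-- by attaching leaves, are checked by computation.
module Submission where

open import Defs
open import Data.Bool using (Bool; true; false; if_then_else_; _∨_; T)
open import Data.Bool.ListAction using (any; all)
open import Data.Bool.Properties using (T?; T-∨)
import Data.Bool.Properties as Bool
open import Data.Empty using (⊥; ⊥-elim)
open import Data.Fin using (Fin; zero; suc; toℕ; inject₁; fromℕ; opposite; #_)
import Data.Fin as Fin
open import Data.Fin.Patterns using (0F; 1F; 2F; 3F; 4F; 5F)
open import Data.Fin.Properties using (_≟_; any?; all?; injective⇒≤; suc-injective; toℕ-injective; opposite-involutive; ¬∀⟶∃¬)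
import Data.Fin.Properties as Fin
open import Data.List using (List; []; _∷_; _++_; length; lookup; head; map; mapMaybe; concatMap; filter; filterᵇ; allFin)
open import Data.List.Properties using (length-map; length-++)
open import Data.List.Membership.DecPropositional using (_∈?_)
open import Data.List.Membership.Propositional using (_∈_; _∉_; lose; find)
open import Data.List.Membership.Propositional.Properties using (∈-map⁺; ∈-++⁺ˡ; ∈-++⁺ʳ; ∈-allFin; ∈-concatMap⁺; ∈-filter⁺; ∈-filter⁻)
open import Data.List.Relation.Unary.All using (All; []; _∷_)
import Data.List.Relation.Unary.All as All
import Data.List.Relation.Unary.All.Properties as All
open import Data.List.Relation.Unary.Any using (Any; here; there; index)
import Data.List.Relation.Unary.Any as Any
import Data.List.Relation.Unary.Any.Properties as Any
open import Data.List.Relation.Unary.Any.Properties using (lookup-index)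
open import Data.Maybe as Maybe using (Maybe; just; nothing; is-just; _<∣>_)
open import Data.Nat using (ℕ; zero; suc; _+_; _≤_; _<_; _∸_; _≡ᵇ_; _≤?_; z≤n; s≤s)
import Data.Nat.Properties as ℕ
open import Data.Product using (Σ; ∃; ∃-syntax; _×_; _,_; proj₁; proj₂; uncurry; map₂)
open import Data.Sum using (_⊎_; inj₁; inj₂)
import Data.Sum as Sum
open import Data.Vec as Vec using (Vec; []; _∷_)
import Data.Vec.Functional as Vector
import Data.Vec.Functional.Properties as Vector
open import Function using (_∘_; _∘₂_; id)
open import Function.Bundles using (_⇔_; mk⇔; mk↔ₛ′; Inverse; Equivalence)
open import Relation.Binary.Definitions using (tri<; tri≈; tri>)
open import Relation.Binary.PropositionalEquality using (_≡_; _≢_; _≗_; refl; sym; trans; cong; cong₂; subst)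
open import Relation.Nullary using (¬_; Dec; yes; no; does; contradiction)
open import Relation.Nullary.Decidable using (decidable-stable; dec-true; dec-false; map′; ¬?; _×-dec_; _⊎-dec_; _→-dec_)
open import Relation.Unary using (Decidable)

-- The constant 8 is 4 + 4. A class that meets both `{l, s}` and `{l′, s′}` has two distinct
-- elements among these four vertices, so only a class with several elements can serve as the
-- partner of an outside singleton. If there are two such classes, each has two elements: one with
-- an outside partner lies inside the four vertices, and only its at most two outside partners are
-- new; one without contributes at most its own two elements. If there is a single such class, of at
-- most three elements, and it has an outside partner, then at most one of its elements is new,
-- together with at most three outside partners. The bound is not sharp, since the largest extremal
-- tree is the path on seven vertices, but it leaves a finite check. Growing trees leaf by leaf
-- serves both halves of the argument: acyclicity turns into structural recursion on the newest
-- leaf, and adjacency becomes a function that can be evaluated.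

private
  variable
    k m n : ℕ

-- Trees grown leaf by leaf

-- leaf t p attaches a new vertex, numbered zero, to the vertex p of t.
data Tree : ℕ → Set where
  root : Tree 1
  leaf : Tree n → Fin n → Tree (suc n)

joined : Tree n → Fin n → Fin n → Bool
joined root       _       _       = false
joined (leaf t p) zero    zero    = false
joined (leaf t p) zero    (suc v) = does (v ≟ p)
joined (leaf t p) (suc u) zero    = does (u ≟ p)
joined (leaf t p) (suc u) (suc v) = joined t u v

joined-sym : (t : Tree n) → ∀ u v → joined t u v ≡ joined t v u
joined-sym root       _       _       = refl
joined-sym (leaf t p) zero    zero    = refl
joined-sym (leaf t p) zero    (suc v) = refl
joined-sym (leaf t p) (suc u) zero    = refl
joined-sym (leaf t p) (suc u) (suc v) = joined-sym t u v

joined-irrefl : (t : Tree n) → ∀ v → joined t v v ≡ false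
joined-irrefl root       _       = refl
joined-irrefl (leaf t p) zero    = refl
joined-irrefl (leaf t p) (suc v) = joined-irrefl t v

⟦_⟧ : Tree n → Graph n
⟦ t ⟧ = record { adj = joined t ; adj-sym = joined-sym t ; adj-irrefl = joined-irrefl t }

vertex : Tree n → Fin n
vertex root       = zero
vertex (leaf _ _) = zero

Adj-sym : (G : Graph n) → ∀ {u v} → Adj G u v → Adj G v u
Adj-sym G {u} {v} uv = trans (adj-sym G v u) uv

Adj-irrefl : (G : Graph n) → ∀ {v} → ¬ Adj G v v
Adj-irrefl G {v} vv with trans (sym vv) (adj-irrefl G v)
... | ()

infix 4 _↪_

record _↪_ (G : Graph m) (H : Graph n) : Set where
  field
    to        : Fin m → Fin n
    injective : ∀ {u v} → to u ≡ to v → u ≡ v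
    preserves : ∀ u v → adj G u v ≡ adj H (to u) (to v)

record SimplePath (G : Graph n) (u v : Fin n) : Set where
  field
    len       : ℕ
    visit     : Fin (suc len) → Fin n
    injective : ∀ {i j} → visit i ≡ visit j → i ≡ j
    start     : visit zero ≡ u
    end       : visit (fromℕ len) ≡ v
    step      : ∀ i → Adj G (visit (inject₁ i)) (visit (suc i))

∷-injective : {f : Fin m → Fin n} {x : Fin n} → (∀ {i j} → f i ≡ f j → i ≡ j) → (∀ i → f i ≢ x) →
              ∀ {i j} → (x Vector.∷ f) i ≡ (x Vector.∷ f) j → i ≡ j
∷-injective inj fresh {zero}  {zero}  _  = refl
∷-injective inj fresh {zero}  {suc j} eq = ⊥-elim (fresh j (sym eq))
∷-injective inj fresh {suc i} {zero}  eq = ⊥-elim (fresh i eq)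
∷-injective inj fresh {suc i} {suc j} eq = cong suc (inj eq)

stay : {G : Graph n} (v : Fin n) → SimplePath G v v
stay v = record
  { len = 0 ; visit = λ _ → v ; injective = λ { {zero} {zero} _ → refl }
  ; start = refl ; end = refl ; step = λ () }

prepend : {G : Graph n} {u v : Fin n} (w : Fin n) (P : SimplePath G u v) →
          (∀ i → SimplePath.visit P i ≢ w) → Adj G w u → SimplePath G w v
prepend {G = G} w P fresh wu = record
  { len = suc len ; visit = w Vector.∷ visit ; injective = ∷-injective injective fresh
  ; start = refl ; end = end
  ; step = λ { zero → trans (cong (adj G w) start) wu ; (suc i) → step i } }
  where open SimplePath P

opposite-inject₁ : ∀ (i : Fin n) → opposite (inject₁ i) ≡ suc (opposite i)
opposite-inject₁ zero    = refl
opposite-inject₁ (suc i) = cong inject₁ (opposite-inject₁ i)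

opposite-fromℕ : ∀ n → opposite (fromℕ n) ≡ zero
opposite-fromℕ zero    = refl
opposite-fromℕ (suc n) = cong inject₁ (opposite-fromℕ n)

reverse : {G : Graph n} {u v : Fin n} → SimplePath G u v → SimplePath G v u
reverse {G = G} P = record
  { len = len ; visit = visit ∘ opposite
  ; injective = λ {i} {j} eq → trans (sym (opposite-involutive i))
                                 (trans (cong opposite (injective eq)) (opposite-involutive j))
  ; start = end
  ; end = trans (cong visit (opposite-fromℕ len)) start
  ; step = λ i → subst (λ j → Adj G (visit j) (visit (inject₁ (opposite i))))
                   (sym (opposite-inject₁ i)) (Adj-sym G (step (opposite i))) }
  where open SimplePath P

mapPath : {G : Graph m} {H : Graph n} (E : G ↪ H) {u v : Fin m} →
          SimplePath G u v → SimplePath H (_↪_.to E u) (_↪_.to E v)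
mapPath E P = record
  { len = len ; visit = to ∘ visit ; injective = injective ∘ E-injective
  ; start = cong to start ; end = cong to end
  ; step = λ i → trans (sym (preserves _ _)) (step i) }
  where
  open _↪_ E renaming (injective to E-injective)
  open SimplePath P

weaken : (t : Tree n) (p : Fin n) → ⟦ t ⟧ ↪ ⟦ leaf t p ⟧
weaken t p = record { to = suc ; injective = suc-injective ; preserves = λ _ _ → refl }

toLeaf : (t : Tree n) {p v : Fin n} → SimplePath ⟦ t ⟧ p v → SimplePath ⟦ leaf t p ⟧ zero (suc v)
toLeaf t {p} P = prepend zero (mapPath (weaken t p) P) (λ _ ()) (dec-true (p ≟ p) refl)

connect : (t : Tree n) → ∀ u v → SimplePath ⟦ t ⟧ u v
connect root       zero    zero    = stay zero
connect (leaf t p) zero    zero    = stay zero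
connect (leaf t p) zero    (suc v) = toLeaf t (connect t p v)
connect (leaf t p) (suc u) zero    = reverse (toLeaf t (connect t p u))
connect (leaf t p) (suc u) (suc v) = mapPath (weaken t p) (connect t u v)

-- Pigeonhole: a missed `v` put in front of `f` would inject `suc n` elements into `n`.
injective⇒surjective : (f : Fin n → Fin n) → (∀ {u v} → f u ≡ f v → u ≡ v) → ∀ v → ∃[ u ] f u ≡ v
injective⇒surjective {n} f inj v with any? (λ u → f u ≟ v)
... | yes found = found
... | no  none  = contradiction
  (injective⇒≤ {f = v Vector.∷ f} (∷-injective inj λ u eq → none (u , eq))) ℕ.1+n≰n

↪⇒≅ : {G H : Graph n} → G ↪ H → G ≅ H
↪⇒≅ E =
  mk↔ₛ′ to (λ v → proj₁ (onto v)) (λ v → proj₂ (onto v)) (λ u → injective (proj₂ (onto (to u)))) ,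
  preserves
  where
  open _↪_ E
  onto : ∀ v → ∃[ u ] to u ≡ v
  onto = injective⇒surjective to injective

≅⇒↪ : (G : Graph m) (H : Graph n) → G ≅ H → G ↪ H
≅⇒↪ _ _ (f , pres) = record
  { to = to ; preserves = pres
  ; injective = λ {u} {v} eq → trans (sym (strictlyInverseʳ u)) (trans (cong from eq) (strictlyInverseʳ v)) }
  where open Inverse f

≅-sym : (G : Graph m) (H : Graph n) → G ≅ H → H ≅ G
≅-sym G H (f , pres) =
  mk↔ₛ′ from to strictlyInverseʳ strictlyInverseˡ ,
  λ u v → sym (trans (pres (from u) (from v)) (cong₂ (adj H) (strictlyInverseˡ u) (strictlyInverseˡ v)))
  where open Inverse f

≅-trans : (G : Graph k) (H : Graph m) (K : Graph n) → G ≅ H → H ≅ K → G ≅ K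
≅-trans _ _ _ (f , pres₁) (g , pres₂) =
  mk↔ₛ′ (G.to ∘ F.to) (F.from ∘ G.from)
    (λ v → trans (cong G.to (F.strictlyInverseˡ _)) (G.strictlyInverseˡ v))
    (λ v → trans (cong F.from (G.strictlyInverseʳ _)) (F.strictlyInverseʳ v)) ,
  λ u v → trans (pres₁ u v) (pres₂ _ _)
  where
  module F = Inverse f
  module G = Inverse g

-- Spanning trees of connected acyclic graphs

rootAt : (G : Graph n) → Fin n → ⟦ root ⟧ ↪ G
rootAt G v = record
  { to = λ _ → v ; injective = λ { {zero} {zero} _ → refl } ; preserves = λ _ _ → sym (adj-irrefl G v) }

extend : {G : Graph n} {t : Tree m} (E : ⟦ t ⟧ ↪ G) (p : Fin m) (w : Fin n) →
         (∀ u → _↪_.to E u ≢ w) → (∀ u → does (u ≟ p) ≡ adj G w (_↪_.to E u)) →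
         ⟦ leaf t p ⟧ ↪ G
extend {m = m} {G} {t} E p w fresh nbrs = record
  { to = w Vector.∷ to ; injective = ∷-injective injective fresh ; preserves = preserves′ }
  where
  open _↪_ E
  preserves′ : ∀ u v → joined (leaf t p) u v ≡ adj G ((w Vector.∷ to) u) ((w Vector.∷ to) v)
  preserves′ zero    zero    = sym (adj-irrefl G w)
  preserves′ zero    (suc v) = nbrs v
  preserves′ (suc u) zero    = trans (nbrs u) (adj-sym G w (to u))
  preserves′ (suc u) (suc v) = preserves u v

crossing : {A : Fin n → Set} → Decidable A → ∀ m (p : Fin (suc m) → Fin n) →
           A (p zero) → ¬ A (p (fromℕ m)) → ∃[ i ] (A (p (inject₁ i)) × ¬ A (p (suc i)))
crossing A? zero    p a ¬a = ⊥-elim (¬a a)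
crossing A? (suc m) p a ¬a with A? (p (suc zero))
... | no  ¬a₁ = zero , a , ¬a₁
... | yes a₁  with crossing A? m (p ∘ suc) a₁ ¬a
...   | i , aᵢ , ¬aᵢ = suc i , aᵢ , ¬aᵢ

-- `u ≢ v` forces an edge in `P`, so `w` and `P` together have at least the three vertices that
-- `HasCycle` demands.
closed⇒cycle : {G : Graph n} {u v : Fin n} (w : Fin n) (P : SimplePath G u v) → u ≢ v →
               (∀ i → SimplePath.visit P i ≢ w) → Adj G w u → Adj G w v → HasCycle G
closed⇒cycle w record { len = zero ; start = start ; end = end } u≢v _ _ _ =
  ⊥-elim (u≢v (trans (sym start) end))
closed⇒cycle {G = G} w P@record { len = suc l } _ fresh wu wv =
  l , visit , (λ _ _ → injective) , step , trans (cong (λ x → adj G x w) end) (Adj-sym G wv)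
  where open SimplePath (prepend w P fresh wu)

module _ {G : Graph n} (connected : Connected G) (acyclic : ¬ HasCycle G) where

  -- A vertex outside an embedded tree has at most one neighbour in it: two would close a cycle.
  growTree : (t : Tree m) → ⟦ t ⟧ ↪ G → m < n → ∃[ p ] (⟦ leaf t p ⟧ ↪ G)
  growTree {m} t E m<n
    with ¬∀⟶∃¬ n (λ w → ∃[ u ] _↪_.to E u ≡ w) (λ w → any? (λ u → _↪_.to E u ≟ w)) covers
    where
    covers : ¬ (∀ w → ∃[ u ] _↪_.to E u ≡ w)
    covers onto = ℕ.1+n≰n (ℕ.≤-trans m<n (injective⇒≤ {f = proj₁ ∘ onto} λ {w} {w′} eq →
      trans (sym (proj₂ (onto w))) (trans (cong (_↪_.to E) eq) (proj₂ (onto w′)))))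
  ... | x , x∉E with connected (_↪_.to E (vertex t)) x
  ... | l , walk , first , last , steps
    -- A walk from the image to the missed vertex `x` has to leave the image; its first vertex
    -- outside becomes the new leaf.
    with crossing (λ w → any? (λ u → _↪_.to E u ≟ w)) l walk (vertex t , sym first)
           (λ inside → x∉E (subst (λ w → ∃[ u ] _↪_.to E u ≡ w) last inside))
  ... | i , (p , at-p) , w∉E = p , extend E p w (λ u eq → w∉E (u , eq)) nbrs
    where
    open _↪_ E
    w = walk (suc i)
    wp : Adj G w (to p)
    wp = trans (cong (adj G w) at-p) (Adj-sym G (steps i))
    nbrs : ∀ u → does (u ≟ p) ≡ adj G w (to u)
    nbrs u with u ≟ p
    ... | yes refl = sym wp
    ... | no  u≢p with adj G w (to u) in wu
    ...   | false = refl
    ...   | true  = ⊥-elim (acyclic (closed⇒cycle w (mapPath E (connect t u p))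
                      (u≢p ∘ injective) (λ _ eq → w∉E (_ , eq)) wu wp))

  spanningTree : ∀ d → d + m ≡ n → (t : Tree m) → ⟦ t ⟧ ↪ G → ∃[ t′ ] (⟦_⟧ {n} t′ ↪ G)
  spanningTree zero    refl t E = t , E
  spanningTree (suc d) refl t E with growTree t E (s≤s (ℕ.m≤n+m _ d))
  ... | p , E′ = spanningTree d (ℕ.+-suc d _) (leaf t p) E′

  isTree⇒≅ : Fin n → ∃[ t ] (⟦_⟧ {n} t ≅ G)
  isTree⇒≅ v with spanningTree (n ∸ 1) (ℕ.m∸n+n≡m (1≤n v)) root (rootAt G v)
    where
    1≤n : ∀ {n} → Fin n → 1 ≤ n
    1≤n zero    = s≤s z≤n
    1≤n (suc _) = s≤s z≤n
  ... | t , E = t , ↪⇒≅ E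

-- Isomorphism invariance and decidability

≅-refl : (G : Graph n) → G ≅ G
≅-refl _ = mk↔ₛ′ id id (λ _ → refl) (λ _ → refl) , λ _ _ → refl

module Transport (G : Graph m) (H : Graph n) (φ : G ≅ H) where

  private
    open module F = Inverse (proj₁ φ) using (to; from)

  infix 4 _∼_
  -- Vertex sets are type-valued predicates, so they are compared by implications in both
  -- directions. At the identity isomorphism the same relation exchanges a set for an equivalent
  -- predicate on one graph.
  _∼_ : VSet m → VSet n → Set
  S ∼ S′ = (∀ {u} → S u → S′ (to u)) × (∀ {v} → S′ v → S (from v))

  from-Adj : ∀ {u v} → Adj H u v → Adj G (from u) (from v)
  from-Adj uv = trans (proj₂ φ _ _) (trans (cong₂ (adj H) (F.strictlyInverseˡ _) (F.strictlyInverseˡ _)) uv)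

  to-Adj : ∀ {u v} → Adj G u v → Adj H (to u) (to v)
  to-Adj uv = trans (sym (proj₂ φ _ _)) uv

  ∼-∪ : ∀ {S S′ T T′} → S ∼ S′ → T ∼ T′ → (S ∪ T) ∼ (S′ ∪ T′)
  ∼-∪ (s , s′) (t , t′) = Sum.map s t , Sum.map s′ t′

  dominating⁺ : ∀ {S S′} → S ∼ S′ → Dominating G S → Dominating H S′
  dominating⁺ {S} {S′} (s , _) dom v with dom (from v)
  ... | inj₁ Sv = inj₁ (subst S′ (F.strictlyInverseˡ v) (s Sv))
  ... | inj₂ (u , Su , vu) =
    inj₂ (to u , s Su , subst (λ w → Adj H w (to u)) (F.strictlyInverseˡ v) (to-Adj vu))

  dominating⁻ : ∀ {S S′} → S ∼ S′ → Dominating H S′ → Dominating G S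
  dominating⁻ {S} {S′} (_ , s′) dom v with dom (to v)
  ... | inj₁ Sv = inj₁ (subst S (F.strictlyInverseʳ v) (s′ Sv))
  ... | inj₂ (u , Su , vu) =
    inj₂ (from u , s′ Su , subst (λ w → Adj G w (from u)) (F.strictlyInverseʳ v) (from-Adj vu))

  atMostOneNbr⁺ : ∀ {S S′} → S ∼ S′ → AtMostOneNbr G S → AtMostOneNbr H S′
  atMostOneNbr⁺ {S} {S′} (s , s′) one v ∉S u w Su Sw vu vw =
    trans (sym (F.strictlyInverseˡ u)) (trans (cong to
      (one (from v) (λ Sv → ∉S (subst S′ (F.strictlyInverseˡ v) (s Sv)))
        (from u) (from w) (s′ Su) (s′ Sw) (from-Adj vu) (from-Adj vw)))
      (F.strictlyInverseˡ w))

  perfectCoalition⁺ : ∀ {S S′ T T′} → S ∼ S′ → T ∼ T′ → PerfectCoalition G S T → PerfectCoalition H S′ T′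
  perfectCoalition⁺ σ τ (disj , ¬S , ¬T , oneS , oneT , dom , one) =
    (λ v Sv Tv → disj (from v) (proj₂ σ Sv) (proj₂ τ Tv)) ,
    ¬S ∘ dominating⁻ σ , ¬T ∘ dominating⁻ τ , atMostOneNbr⁺ σ oneS , atMostOneNbr⁺ τ oneT ,
    dominating⁺ (∼-∪ σ τ) dom , atMostOneNbr⁺ (∼-∪ σ τ) one

  isPRCPartition⁺ : ∀ {c : Fin m → Fin k} {c′ : Fin n → Fin k} → (∀ i → Class c i ∼ Class c′ i) →
                    IsPRCPartition G k c → IsPRCPartition H k c′
  isPRCPartition⁺ same (onto , ok) =
    (λ i → to (proj₁ (onto i)) , proj₁ (same i) (proj₂ (onto i))) , λ i → Sum.map
      (λ (dom , one) → dominating⁺ (same i) dom , λ u v ui vi →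
        trans (sym (F.strictlyInverseˡ u))
          (trans (cong to (one _ _ (proj₂ (same i) ui) (proj₂ (same i) vi))) (F.strictlyInverseˡ v)))
      (λ (j , pc) → j , perfectCoalition⁺ (same i) (same j) pc) (ok i)

  hasPRCPartition⁺ : HasPRCPartition G k → HasPRCPartition H k
  hasPRCPartition⁺ (c , ok) = c ∘ from ,
    isPRCPartition⁺ (λ i → (λ {u} → trans (cong c (F.strictlyInverseʳ u))) , id) ok

open Transport using (hasPRCPartition⁺; isPRCPartition⁺; perfectCoalition⁺)

Adj? : (G : Graph n) → ∀ u v → Dec (Adj G u v)
Adj? G u v = adj G u v Bool.≟ true

module _ (G : Graph n) where

  dominates? : {S : VSet n} → Decidable S → Decidable (λ v → S v ⊎ (∃[ u ] (S u × Adj G v u)))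
  dominates? S? v = S? v ⊎-dec any? (λ u → S? u ×-dec Adj? G v u)

  dominating? : {S : VSet n} → Decidable S → Dec (Dominating G S)
  dominating? S? = all? (dominates? S?)

  -- The hypotheses are reordered so that the inner quantifier over `w` is reached only for
  -- neighbours `u` in the set.
  atMostOneNbr? : {S : VSet n} → Decidable S → Dec (AtMostOneNbr G S)
  atMostOneNbr? S? = map′
    (λ one v v∉S u w u∈S w∈S vu vw → one v v∉S u vu u∈S w vw w∈S)
    (λ one v v∉S u vu u∈S w vw w∈S → one v v∉S u w u∈S w∈S vu vw)
    (all? λ v → ¬? (S? v) →-dec (all? λ u → Adj? G v u →-dec (S? u →-dec
      (all? λ w → Adj? G v w →-dec (S? w →-dec (u ≟ w))))))

  -- Domination by the union is tested first because it fails most often.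
  perfectCoalition? : {S T : VSet n} → Decidable S → Decidable T → Dec (PerfectCoalition G S T)
  perfectCoalition? S? T? =
    map′ (λ (dom , disj , ¬S , ¬T , oneS , oneT , one) → disj , ¬S , ¬T , oneS , oneT , dom , one)
         (λ (disj , ¬S , ¬T , oneS , oneT , dom , one) → dom , disj , ¬S , ¬T , oneS , oneT , one)
         (dominating? ∪? ×-dec (all? (λ v → S? v →-dec ¬? (T? v))) ×-dec
          ¬? (dominating? S?) ×-dec ¬? (dominating? T?) ×-dec
          atMostOneNbr? S? ×-dec atMostOneNbr? T? ×-dec atMostOneNbr? ∪?)
    where
    ∪? = λ v → S? v ⊎-dec T? v

  isPRCPartition? : ∀ k (c : Fin n → Fin k) → Dec (IsPRCPartition G k c)
  isPRCPartition? k c =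
    all? (λ i → any? (class? i)) ×-dec all? (λ i →
      (dominating? (class? i) ×-dec all? (λ u → all? λ v → class? i u →-dec (class? i v →-dec (u ≟ v))))
      ⊎-dec any? (λ j → perfectCoalition? (class? i) (class? j)))
    where
    class? : ∀ i → Decidable (Class c i)
    class? i v = c v ≟ i

-- Function extensionality is not available, hence the hypothesis that P respects _≗_.
anyFunction? : ∀ n {P : (Fin n → Fin k) → Set} → (∀ f → Dec (P f)) →
               (∀ {f g} → f ≗ g → P f → P g) → Dec (∃ P)
anyFunction? zero    P? resp with P? (λ ())
... | yes p = yes (_ , p)
... | no ¬p = no λ (_ , p) → ¬p (resp (λ ()) p)
anyFunction? (suc n) P? resp
  with any? (λ a → anyFunction? n (λ f → P? (a Vector.∷ f)) (λ fg → resp (Vector.∷-cong refl fg)))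
... | yes (a , f , p) = yes (a Vector.∷ f , p)
... | no none = no λ (f , p) → none (f zero , f ∘ suc , resp (λ { zero → refl ; (suc _) → refl }) p)

hasPRCPartition? : (G : Graph n) → ∀ k → Dec (HasPRCPartition G k)
hasPRCPartition? G k = anyFunction? _ (isPRCPartition? G k) λ {f} {g} fg →
  isPRCPartition⁺ G G (≅-refl G) {c = f} {c′ = g} λ i → (λ {u} → trans (sym (fg u))) , (λ {u} → trans (fg u))

hasPRCPartition⇒≤ : (G : Graph n) → HasPRCPartition G k → k ≤ n
hasPRCPartition⇒≤ _ (c , onto , _) = injective⇒≤ {f = proj₁ ∘ onto}
  λ {i} {j} eq → trans (sym (proj₂ (onto i))) (trans (cong c eq) (proj₂ (onto j)))

-- `PRC` is a relation, so its value has to be produced: the search descends from `n`, keeping an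
-- upper bound for all partition sizes.
∃PRC : (G : Graph n) → ∃[ p ] PRC G p
∃PRC {n} G = search n (λ k → hasPRCPartition⇒≤ G)
  where
  search : ∀ b → (∀ k → HasPRCPartition G k → k ≤ b) → ∃[ p ] PRC G p
  search b bound with hasPRCPartition? G b
  ... | yes has = b , inj₁ (has , bound)
  search zero    bound | no ¬has =
    0 , inj₂ (refl , λ k has → ¬has (subst (HasPRCPartition G) (ℕ.n≤0⇒n≡0 (bound k has)) has))
  search (suc b) bound | no ¬has = search b λ k has →
    ℕ.≤-pred (ℕ.≤∧≢⇒< (bound k has) λ { refl → ¬has has })

-- Stars and leaves with distinct supports

does⇒ : {A : Set} (a? : Dec A) → does a? ≡ true → A
does⇒ (yes a) _ = a

-- The newest vertex has one neighbour only, so in a triangle through it the other two corners would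
-- coincide and carry a loop.
noTriangle : (t : Tree n) → ∀ a b c → Adj ⟦ t ⟧ a b → Adj ⟦ t ⟧ b c → Adj ⟦ t ⟧ a c → ⊥
noTriangle (leaf t p) zero    (suc b) (suc c) ab bc ac =
  Adj-irrefl ⟦ t ⟧ (subst (Adj ⟦ t ⟧ b) (trans (does⇒ (c ≟ p) ac) (sym (does⇒ (b ≟ p) ab))) bc)
noTriangle (leaf t p) (suc a) zero    (suc c) ab bc ac =
  Adj-irrefl ⟦ t ⟧ (subst (Adj ⟦ t ⟧ a) (trans (does⇒ (c ≟ p) bc) (sym (does⇒ (a ≟ p) ab))) ac)
noTriangle (leaf t p) (suc a) (suc b) zero    ab bc ac =
  Adj-irrefl ⟦ t ⟧ (subst (Adj ⟦ t ⟧ a) (trans (does⇒ (b ≟ p) bc) (sym (does⇒ (a ≟ p) ac))) ab)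
noTriangle (leaf t p) (suc a) (suc b) (suc c) ab bc ac = noTriangle t a b c ab bc ac

-- If the newest vertex is a corner, both corners next to it are its unique neighbour `p`.
noSquare : (t : Tree n) → ∀ a b c d → Adj ⟦ t ⟧ a b → Adj ⟦ t ⟧ b c → Adj ⟦ t ⟧ c d → Adj ⟦ t ⟧ d a →
           a ≡ c ⊎ b ≡ d
noSquare (leaf t p) zero    _       zero    _       _  _  _  _  = inj₁ refl
noSquare (leaf t p) _       zero    _       zero    _  _  _  _  = inj₂ refl
noSquare (leaf t p) zero    (suc b) (suc c) (suc d) ab bc cd da =
  inj₂ (cong suc (trans (does⇒ (b ≟ p) ab) (sym (does⇒ (d ≟ p) da))))
noSquare (leaf t p) (suc a) (suc b) zero    (suc d) ab bc cd da =
  inj₂ (cong suc (trans (does⇒ (b ≟ p) bc) (sym (does⇒ (d ≟ p) cd))))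
noSquare (leaf t p) (suc a) zero    (suc c) (suc d) ab bc cd da =
  inj₁ (cong suc (trans (does⇒ (a ≟ p) ab) (sym (does⇒ (c ≟ p) bc))))
noSquare (leaf t p) (suc a) (suc b) (suc c) zero    ab bc cd da =
  inj₁ (cong suc (trans (does⇒ (a ≟ p) da) (sym (does⇒ (c ≟ p) cd))))
noSquare (leaf t p) (suc a) (suc b) (suc c) (suc d) ab bc cd da =
  Sum.map (cong suc) (cong suc) (noSquare t a b c d ab bc cd da)

LeafOf : Graph n → Fin n → Fin n → Set
LeafOf G l s = Adj G l s × (∀ w → Adj G l w → w ≡ s)

Star : Graph n → Set
Star G = ∃[ c ] (∀ v → v ≡ c ⊎ LeafOf G v c)

record TwoLeaves (G : Graph n) : Set where
  constructor twoLeaves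
  field
    l s l′ s′ : Fin n
    leaf₁ : LeafOf G l s
    leaf₂ : LeafOf G l′ s′
    l≢l′  : l ≢ l′
    l≢s′  : l ≢ s′
    s≢l′  : s ≢ l′
    s≢s′  : s ≢ s′

newLeaf : (t : Tree n) (p : Fin n) → LeafOf ⟦ leaf t p ⟧ zero (suc p)
newLeaf t p = dec-true (p ≟ p) refl , λ { (suc w) zw → cong suc (does⇒ (w ≟ p) zw) }

oldLeaf : (t : Tree n) {p l s : Fin n} → LeafOf ⟦ t ⟧ l s → l ≢ p → LeafOf ⟦ leaf t p ⟧ (suc l) (suc s)
oldLeaf t {p} {l} (ls , only) l≢p =
  ls , λ { zero lw → ⊥-elim (l≢p (does⇒ (l ≟ p) lw)) ; (suc w) lw → cong suc (only w lw) }

-- A leaf attached to a star away from its centre pairs up with any remaining old leaf; if there is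
-- none, the star was a single edge and the result is again a star, centred at `p`. In a tree with
-- two leaves already, attaching to `l` or `l′` replaces that leaf by the new one, whose support is
-- the old leaf; attaching elsewhere changes neither.
star⊎twoLeaves : (t : Tree n) → Star ⟦ t ⟧ ⊎ TwoLeaves ⟦ t ⟧
star⊎twoLeaves root = inj₁ (zero , λ { zero → inj₁ refl })
star⊎twoLeaves (leaf t p) with star⊎twoLeaves t
star⊎twoLeaves (leaf t p) | inj₁ (c , star) with p ≟ c
... | yes refl = inj₁ (suc c , λ
      { zero    → inj₂ (newLeaf t c)
      ; (suc v) → Sum.[ inj₁ ∘ cong suc , (λ l → inj₂ (oldLeaf t l λ { refl → Adj-irrefl ⟦ t ⟧ (proj₁ l) })) ] (star v) })
... | no p≢c with star p
...   | inj₁ p≡c = ⊥-elim (p≢c p≡c)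
...   | inj₂ (pc , _) with any? (λ u → ¬? (u ≟ c) ×-dec ¬? (u ≟ p))
...     | yes (u , u≢c , u≢p) = inj₂ (twoLeaves zero (suc p) (suc u) (suc c) (newLeaf t p) (oldLeaf t (leafAt u u≢c) u≢p)
            (λ ()) (λ ()) (u≢p ∘ sym ∘ suc-injective) (p≢c ∘ suc-injective))
  where
  leafAt : ∀ u → u ≢ c → LeafOf ⟦ t ⟧ u c
  leafAt u u≢c = Sum.[ ⊥-elim ∘ u≢c , id ]′ (star u)
...     | no none = inj₁ (suc p , λ
            { zero → inj₂ (newLeaf t p)
            ; (suc v) → centre v })
  where
  only : ∀ v → v ≢ p → v ≡ c
  only v v≢p with v ≟ c
  ... | yes eq = eq
  ... | no v≢c = ⊥-elim (none (v , v≢c , v≢p))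
  centre : ∀ v → suc v ≡ suc p ⊎ LeafOf ⟦ leaf t p ⟧ (suc v) (suc p)
  centre v with v ≟ p
  ... | yes eq = inj₁ (cong suc eq)
  ... | no v≢p with only v v≢p
  ...   | refl = inj₂ (oldLeaf t (Adj-sym ⟦ t ⟧ pc , nbr) v≢p)
    where
    nbr : ∀ w → Adj ⟦ t ⟧ v w → w ≡ p
    nbr w vw with w ≟ p
    ... | yes eq = eq
    ... | no w≢p with only w w≢p
    ...   | refl = ⊥-elim (Adj-irrefl ⟦ t ⟧ vw)
star⊎twoLeaves (leaf t p) | inj₂ (twoLeaves l s l′ s′ leaf₁ leaf₂ l≢l′ l≢s′ s≢l′ s≢s′)
  with l ≟ p | l′ ≟ p
... | yes refl | _ = inj₂ (twoLeaves zero (suc l) (suc l′) (suc s′)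
      (newLeaf t l) (oldLeaf t leaf₂ (l≢l′ ∘ sym)) (λ ()) (λ ())
      (l≢l′ ∘ suc-injective) (l≢s′ ∘ suc-injective))
... | no l≢p | yes refl = inj₂ (twoLeaves (suc l) (suc s) zero (suc l′) (oldLeaf t leaf₁ l≢p) (newLeaf t l′) (λ ())
      (l≢l′ ∘ suc-injective) (λ ()) (s≢l′ ∘ suc-injective))
... | no l≢p | no l′≢p = inj₂ (twoLeaves (suc l) (suc s) (suc l′) (suc s′)
      (oldLeaf t leaf₁ l≢p) (oldLeaf t leaf₂ l′≢p)
      (l≢l′ ∘ suc-injective) (l≢s′ ∘ suc-injective) (s≢l′ ∘ suc-injective) (s≢s′ ∘ suc-injective))

-- Covering lists, partners of a class, and stars

covering⇒≤ : (vs : List (Fin n)) → (∀ v → v ∈ vs) → n ≤ length vs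
covering⇒≤ vs covers = injective⇒≤ {f = λ v → index (covers v)} λ {u} {v} eq →
  trans (lookup-index (covers u)) (trans (cong (lookup vs) eq) (sym (lookup-index (covers v))))

∃∉ : (vs : List (Fin n)) → length vs < n → ∃[ v ] v ∉ vs
∃∉ {n} vs short = ¬∀⟶∃¬ n (_∈ vs) (λ v → _∈?_ _≟_ v vs) (ℕ.<⇒≱ short ∘ covering⇒≤ vs)

module _ (t : Tree n) where

  private
    G = ⟦ t ⟧

  -- All x in X lie in the closed neighbourhood of an undominated vertex z. Either z itself is in X,
  -- and then X has at most two elements, or distinct elements of X have distinct neighbours in Y,
  -- as otherwise they would form a 4-cycle together with z.
  coverPartners : {X Y : VSet n} → Decidable X → (z : Fin n) → ¬ Y z → (∀ u → Y u → ¬ Adj G z u) →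
                  (∀ x → X x → ¬ Y x) → (∀ x → X x → PerfectDominating G ((_≡ x) ∪ Y)) →
                  (ys : List (Fin n)) → (∀ v → Y v → v ∈ ys) → 2 ≤ length ys →
                  ∃[ cs ] (length cs ≤ length ys × (∀ x → X x → x ∈ cs))
  coverPartners {X} {Y} X? z z∉Y z≁Y X∩Y perfect ys Y⊆ys 2≤ys = cover (X? z)
    where
    near : ∀ x → X x → x ≢ z → Adj G z x
    near x x∈X x≢z with proj₁ (perfect x x∈X) z
    ... | inj₁ (inj₁ z≡x)             = ⊥-elim (x≢z (sym z≡x))
    ... | inj₁ (inj₂ z∈Y)             = ⊥-elim (z∉Y z∈Y)
    ... | inj₂ (u , inj₁ refl , zu)   = zu
    ... | inj₂ (u , inj₂ u∈Y , zu)    = ⊥-elim (z≁Y u u∈Y zu)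
    nbrInY : ∀ x x′ → X x → X x′ → x ≢ x′ → x ≢ z → x′ ≢ z → ∃[ y ] (Y y × Adj G x y)
    nbrInY x x′ x∈X x′∈X x≢x′ x≢z x′≢z with proj₁ (perfect x′ x′∈X) x
    ... | inj₁ (inj₁ x≡x′)            = ⊥-elim (x≢x′ x≡x′)
    ... | inj₁ (inj₂ x∈Y)             = ⊥-elim (X∩Y x x∈X x∈Y)
    -- Domination of `x` by `x′` would close a triangle with `z`, so it comes from `Y`.
    ... | inj₂ (u , inj₁ refl , xx′)  = ⊥-elim (noTriangle t z x u (near x x∈X x≢z) xx′ (near u x′∈X x′≢z))
    ... | inj₂ (y , inj₂ y∈Y , xy)    = y , y∈Y , xy
    Covered = ∃[ cs ] (length cs ≤ length ys × (∀ x → X x → x ∈ cs))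
    cover : Dec (X z) → Covered
    cover (yes z∈X) with any? (λ x → X? x ×-dec ¬? (x ≟ z))
    ... | no none = z ∷ [] , ℕ.≤-trans (s≤s z≤n) 2≤ys , here ∘₂ only
      where
      only : ∀ x → X x → x ≡ z
      only x x∈X with x ≟ z
      ... | yes eq = eq
      ... | no x≢z = ⊥-elim (none (x , x∈X , x≢z))
    ... | yes (x₁ , x₁∈X , x₁≢z) = z ∷ x₁ ∷ [] , 2≤ys , member
      where
      member : ∀ x → X x → x ∈ z ∷ x₁ ∷ []
      member x x∈X with x ≟ z | x ≟ x₁
      ... | yes eq | _      = here eq
      ... | no _   | yes eq = there (here eq)
      -- A third element `x` would be adjacent to `z` and to some `y` in `Y`; uniqueness of
      -- neighbours in `{z} ∪ Y` then gives `z ≡ y`, although `z` is not in `Y`.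
      ... | no x≢z | no x≢x₁ with nbrInY x x₁ x∈X x₁∈X x≢x₁ x≢z x₁≢z
      ...   | y , y∈Y , xy = ⊥-elim (z∉Y (subst Y (sym (proj₂ (perfect z z∈X) x
                Sum.[ x≢z , X∩Y x x∈X ] z y (inj₁ refl) (inj₂ y∈Y) (Adj-sym G (near x x∈X x≢z)) xy)) y∈Y))
    cover (no z∉X) with any? X?
    ... | no none = [] , z≤n , λ x x∈X → ⊥-elim (none (x , x∈X))
    ... | yes (x₀ , x₀∈X) with any? (λ x → X? x ×-dec ¬? (x ≟ x₀))
    ...   | no none = x₀ ∷ [] , ℕ.≤-trans (s≤s z≤n) 2≤ys , here ∘₂ only
      where
      only : ∀ x → X x → x ≡ x₀
      only x x∈X with x ≟ x₀
      ... | yes eq = eq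
      ... | no x≢x₀ = ⊥-elim (none (x , x∈X , x≢x₀))
    ...   | yes (x₁ , x₁∈X , x₁≢x₀) = map pick ys , ℕ.≤-reflexive (length-map pick ys) , member
      where
      ≢z : ∀ {x} → X x → x ≢ z
      ≢z x∈X refl = z∉X x∈X
      candidate? : ∀ y → Dec (∃[ x ] (X x × Adj G y x))
      candidate? y = any? (λ x → X? x ×-dec Adj? G y x)
      pick : Fin n → Fin n
      pick y with candidate? y
      ... | yes (x , _) = x
      -- An arbitrary filler: `member` only uses those `y` that have a neighbour in `X`.
      ... | no  _       = z
      pick≡ : ∀ x y → X x → Y y → Adj G x y → x ≡ pick y
      pick≡ x y x∈X y∈Y xy with candidate? y
      ... | no none = ⊥-elim (none (x , x∈X , Adj-sym G xy))
      -- Two elements of `X` next to the same `y` give the closed walk `x`, `y`, `x′`, `z`, and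
      -- `y ≡ z` is impossible.
      ... | yes (x′ , x′∈X , yx′) with noSquare t x y x′ z xy yx′ (Adj-sym G (near x′ x′∈X (≢z x′∈X))) (near x x∈X (≢z x∈X))
      ...   | inj₁ eq   = eq
      ...   | inj₂ refl = ⊥-elim (z∉Y y∈Y)
      other : ∀ x → ∃[ x′ ] (X x′ × x ≢ x′)
      other x with x ≟ x₀
      ... | yes refl = x₁ , x₁∈X , x₁≢x₀ ∘ sym
      ... | no x≢x₀  = x₀ , x₀∈X , x≢x₀
      member : ∀ x → X x → x ∈ map pick ys
      member x x∈X with other x
      ... | x′ , x′∈X , x≢x′ with nbrInY x x′ x∈X x′∈X x≢x′ (≢z x∈X) (≢z x′∈X)
      ...   | y , y∈Y , xy = subst (_∈ map pick ys) (sym (pick≡ x y x∈X y∈Y xy)) (∈-map⁺ pick (Y⊆ys y y∈Y))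

starHasNoPRCPartition : (G : Graph n) → 2 < n → Star G → ¬ HasPRCPartition G k
starHasNoPRCPartition {n} G 2<n (o , star) (c , onto , ok) =
  leafClass (map₂ (_∘ here) (∃∉ (o ∷ []) (ℕ.<-trans (s≤s (s≤s z≤n)) 2<n)))
  where
  centreDominates : {S : VSet n} → S o → Dominating G S
  centreDominates o∈S v with star v
  ... | inj₁ refl     = inj₁ o∈S
  ... | inj₂ (vo , _) = inj₂ (o , o∈S , vo)
  apart : ∀ {u} → u ≢ o → c u ≢ c o
  apart {u} u≢o cu≡co with ok (c o)
  ... | inj₁ (_ , one)          = u≢o (one u o cu≡co refl)
  ... | inj₂ (_ , _ , ¬dom , _) = ¬dom (centreDominates refl)
  o-Adj : ∀ {u} → u ≢ o → Adj G o u
  o-Adj {u} u≢o with star u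
  ... | inj₁ u≡o      = ⊥-elim (u≢o u≡o)
  ... | inj₂ (uo , _) = Adj-sym G uo
  leafClass : ∃[ u ] u ≢ o → ⊥
  leafClass (u , u≢o) with ok (c u)
  -- A single leaf cannot dominate: a third vertex `w` is a leaf as well, and its only neighbour is
  -- the centre.
  leafClass (u , u≢o) | inj₁ (dom , one) with ∃∉ (u ∷ o ∷ []) 2<n
  ... | w , w∉ with star w | dom w
  ...   | inj₁ w≡o        | _                = w∉ (there (here w≡o))
  ...   | inj₂ _          | inj₁ cw≡cu       = w∉ (here (one w u cw≡cu refl))
  ...   | inj₂ (_ , only) | inj₂ (x , x∈ , wx) = u≢o (trans (one u x refl x∈) (only x wx))
  leafClass (u , u≢o) | inj₂ (j , disj , _ , ¬dom , _ , _ , _ , one) with onto j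
  ... | v , cv≡j = disj u refl (subst (λ w → c w ≡ j) (sym u≡v) cv≡j)
    where
    v≢o : v ≢ o
    v≢o refl = ¬dom (centreDominates cv≡j)
    o∉ : ¬ (c o ≡ c u ⊎ c o ≡ j)
    o∉ (inj₁ eq) = apart u≢o (sym eq)
    o∉ (inj₂ eq) = ¬dom (centreDominates eq)
    u≡v : u ≡ v
    u≡v = one o o∉ u v (inj₁ refl) (inj₂ cv≡j) (o-Adj u≢o) (o-Adj v≢o)

-- The bound n ≤ 8

Fibre : (Fin n → Fin n) → Fin n → VSet n
Fibre e v u = e u ≡ e v

-- The alternative of a singleton dominating class is left out: two leaves with distinct supports
-- exclude it, see `noDominatingVertex`.
Coalescent : Graph n → (Fin n → Fin n) → Set
Coalescent G e = ∀ v → ∃[ w ] PerfectCoalition G (Fibre e v) (Fibre e w)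

module _ (t : Tree n) (two : TwoLeaves ⟦ t ⟧)
         (e : Fin n → Fin n) (a a′ : Fin n) (moved : ∀ v → e v ≡ v ⊎ v ≡ a ⊎ v ≡ a′)
         (coalescent : Coalescent ⟦ t ⟧ e) where

  private
    open TwoLeaves two
    G = ⟦ t ⟧

    -- `M` contains every class with more than one element: two vertices with the same image under
    -- `e` are not both fixed, so one is `a` or `a′`, and the other is `a`, `a′` or the common
    -- image. Hence a vertex outside `M` is a class by itself.
    L M : List (Fin n)
    L = l ∷ s ∷ l′ ∷ s′ ∷ []
    M = a ∷ e a ∷ a′ ∷ e a′ ∷ []

    Outside : Fin n → Set
    Outside x = x ∉ L × x ∉ M

    Partner : Fin n → Fin n → Set
    Partner b x = Outside x × PerfectCoalition G (Fibre e x) (Fibre e b)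

    fibre? : ∀ v → Decidable (Fibre e v)
    fibre? v u = e u ≟ e v

    partner? : ∀ b → Decidable (Partner b)
    partner? b x = (¬? (_∈?_ _≟_ x L) ×-dec ¬? (_∈?_ _≟_ x M)) ×-dec
                   perfectCoalition? G (fibre? x) (fibre? b)

    fixed : ∀ {x} → x ∉ M → e x ≡ x
    fixed {x} x∉M with moved x
    ... | inj₁ eq          = eq
    ... | inj₂ (inj₁ refl) = ⊥-elim (x∉M (here refl))
    ... | inj₂ (inj₂ refl) = ⊥-elim (x∉M (there (there (here refl))))

    singletonFibre : ∀ {x u} → x ∉ M → Fibre e x u → u ≡ x
    singletonFibre {x} {u} x∉M eq with moved u
    ... | inj₁ eu≡u        = trans (sym eu≡u) (trans eq (fixed x∉M))
    ... | inj₂ (inj₁ refl) = ⊥-elim (x∉M (there (here (trans (sym (fixed x∉M)) (sym eq)))))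
    ... | inj₂ (inj₂ refl) = ⊥-elim (x∉M (there (there (there (here (trans (sym (fixed x∉M)) (sym eq)))))))

    meets : ∀ {x w q r} → LeafOf G q r → x ∉ M → x ≢ q → x ≢ r → PerfectCoalition G (Fibre e x) (Fibre e w) →
           Fibre e w q ⊎ Fibre e w r
    meets {q = q} (_ , only) x∉M x≢q x≢r (_ , _ , _ , _ , _ , dom , _) with dom q
    ... | inj₁ (inj₁ q∈x)           = ⊥-elim (x≢q (sym (singletonFibre x∉M q∈x)))
    ... | inj₁ (inj₂ q∈w)           = inj₁ q∈w
    ... | inj₂ (u , inj₁ u∈x , qu)  = ⊥-elim (x≢r (trans (sym (singletonFibre x∉M u∈x)) (only u qu)))
    ... | inj₂ (u , inj₂ u∈w , qu)  = inj₂ (subst (Fibre e _) (only u qu) u∈w)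

    straddles : ∀ {x w} → Outside x → PerfectCoalition G (Fibre e x) (Fibre e w) →
                ∃[ p ] ∃[ q ] (p ≢ q × p ∈ L × q ∈ L × Fibre e w p × Fibre e w q)
    straddles (x∉L , x∉M) pc
      with meets leaf₁ x∉M (x∉L ∘ here) (x∉L ∘ there ∘ here) pc
         | meets leaf₂ x∉M (x∉L ∘ there ∘ there ∘ here) (x∉L ∘ there ∘ there ∘ there ∘ here) pc
    ... | inj₁ l∈ | inj₁ l′∈ = l , l′ , l≢l′ , here refl , there (there (here refl)) , l∈ , l′∈
    ... | inj₁ l∈ | inj₂ s′∈ = l , s′ , l≢s′ , here refl , there (there (there (here refl))) , l∈ , s′∈
    ... | inj₂ s∈ | inj₁ l′∈ = s , l′ , s≢l′ , there (here refl) , there (there (here refl)) , s∈ , l′∈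
    ... | inj₂ s∈ | inj₂ s′∈ = s , s′ , s≢s′ , there (here refl) , there (there (there (here refl))) , s∈ , s′∈

    retarget : ∀ {x w b} → Outside x → PerfectCoalition G (Fibre e x) (Fibre e w) → Fibre e w b → Partner b x
    retarget out pc b∈w = out , subst (λ i → PerfectCoalition G (Fibre e _) (λ u → e u ≡ i)) (sym b∈w) pc

    outside⇒partner : ∀ x → Outside x → Partner a x ⊎ Partner a′ x
    outside⇒partner x out with coalescent x
    ... | w , pc with straddles out pc
    ...   | p , q , p≢q , _ , _ , p∈w , q∈w with moved p | moved q
    -- Two fixed points of `e` in one fibre coincide, so `p` or `q` is moved and the partner class
    -- is that of `a` or `a′`.
    ...     | inj₁ ep≡p        | inj₁ eq≡q        = ⊥-elim (p≢q (trans (sym ep≡p) (trans p∈w (trans (sym q∈w) eq≡q))))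
    ...     | inj₂ (inj₁ refl) | _                = inj₁ (retarget out pc p∈w)
    ...     | inj₂ (inj₂ refl) | _                = inj₂ (retarget out pc p∈w)
    ...     | inj₁ _           | inj₂ (inj₁ refl) = inj₁ (retarget out pc q∈w)
    ...     | inj₁ _           | inj₂ (inj₂ refl) = inj₂ (retarget out pc q∈w)

    -- The known partner `x₀` certifies that the class of `b` is not dominating, which supplies the
    -- undominated vertex `z`.
    coverPartnersOf : ∀ b x₀ → Partner b x₀ → (ys : List (Fin n)) → (∀ v → Fibre e b v → v ∈ ys) → 2 ≤ length ys →
                      ∃[ cs ] (length cs ≤ length ys × (∀ x → Partner b x → x ∈ cs))
    coverPartnersOf b x₀ (_ , _ , _ , ¬dom , _) ys Y⊆ys 2≤ys
      with ¬∀⟶∃¬ n _ (dominates? G (fibre? b)) ¬dom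
    ... | z , z-free = coverPartners t (partner? b) z (z-free ∘ inj₁) (λ u u∈b zu → z-free (inj₂ (u , u∈b , zu)))
          (λ x (_ , disj , _) x∈b → disj x refl x∈b) perfect ys Y⊆ys 2≤ys
      where
      perfect : ∀ x → Partner b x → PerfectDominating G ((_≡ x) ∪ Fibre e b)
      perfect x ((_ , x∉M) , _ , _ , _ , _ , _ , dom , one) =
        Transport.dominating⁺ G G (≅-refl G) same dom ,
        Transport.atMostOneNbr⁺ G G (≅-refl G) same one
        where
        same : (∀ {u} → (Fibre e x ∪ Fibre e b) u → ((_≡ x) ∪ Fibre e b) u) ×
               (∀ {u} → ((_≡ x) ∪ Fibre e b) u → (Fibre e x ∪ Fibre e b) u)
        same = Sum.map₁ (singletonFibre x∉M) , Sum.map₁ (cong e)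

    covered⇒≤8 : (vs : List (Fin n)) → (∀ v → v ∈ L ++ vs) → length vs ≤ 4 → n ≤ 8
    covered⇒≤8 vs covered ≤4 = ℕ.≤-trans (covering⇒≤ (L ++ vs) covered) (ℕ.+-monoʳ-≤ 4 ≤4)

    trichotomy : ∀ v → v ∈ L ⊎ v ∈ M ⊎ Outside v
    trichotomy v with _∈?_ _≟_ v L | _∈?_ _≟_ v M
    ... | yes v∈L | _       = inj₁ v∈L
    ... | no _    | yes v∈M = inj₂ (inj₁ v∈M)
    ... | no v∉L  | no v∉M  = inj₂ (inj₂ (v∉L , v∉M))

    -- Applied to a class of at most three elements, two of which lie in `L`: only `r` then has to
    -- be counted in addition to `L`.
    thirdOf : ∀ {p q : Fin n} (x y z : Fin n) → p ≢ q → p ∈ x ∷ y ∷ z ∷ [] → q ∈ x ∷ y ∷ z ∷ [] →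
              ∃[ r ] (∀ v → v ∈ x ∷ y ∷ z ∷ [] → v ≡ p ⊎ v ≡ q ⊎ v ≡ r)
    thirdOf x y z p≢q (here refl) (here refl) = ⊥-elim (p≢q refl)
    thirdOf x y z p≢q (here refl) (there (here refl)) = z , λ
      { v (here eq) → inj₁ eq ; v (there (here eq)) → inj₂ (inj₁ eq) ; v (there (there (here eq))) → inj₂ (inj₂ eq) }
    thirdOf x y z p≢q (here refl) (there (there (here refl))) = y , λ
      { v (here eq) → inj₁ eq ; v (there (here eq)) → inj₂ (inj₂ eq) ; v (there (there (here eq))) → inj₂ (inj₁ eq) }
    thirdOf x y z p≢q (there (here refl)) (here refl) = z , λ
      { v (here eq) → inj₂ (inj₁ eq) ; v (there (here eq)) → inj₁ eq ; v (there (there (here eq))) → inj₂ (inj₂ eq) }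
    thirdOf x y z p≢q (there (here refl)) (there (here refl)) = ⊥-elim (p≢q refl)
    thirdOf x y z p≢q (there (here refl)) (there (there (here refl))) = x , λ
      { v (here eq) → inj₂ (inj₂ eq) ; v (there (here eq)) → inj₁ eq ; v (there (there (here eq))) → inj₂ (inj₁ eq) }
    thirdOf x y z p≢q (there (there (here refl))) (here refl) = y , λ
      { v (here eq) → inj₂ (inj₁ eq) ; v (there (here eq)) → inj₂ (inj₂ eq) ; v (there (there (here eq))) → inj₁ eq }
    thirdOf x y z p≢q (there (there (here refl))) (there (here refl)) = x , λ
      { v (here eq) → inj₂ (inj₂ eq) ; v (there (here eq)) → inj₂ (inj₁ eq) ; v (there (there (here eq))) → inj₁ eq }
    thirdOf x y z p≢q (there (there (here refl))) (there (there (here refl))) = ⊥-elim (p≢q refl)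

    inL : ∀ {p v} → p ∈ L → v ≡ p → v ∈ L
    inL p∈L refl = p∈L

    oneClass : e a ≡ e a′ → n ≤ 8
    oneClass ea≡ea′ = bound (any? (partner? a))
      where
      ys = a ∷ a′ ∷ e a ∷ []
      Y⊆ys : ∀ v → Fibre e a v → v ∈ ys
      Y⊆ys v ev≡ea with moved v
      ... | inj₁ ev≡v        = there (there (here (trans (sym ev≡v) ev≡ea)))
      ... | inj₂ (inj₁ refl) = here refl
      ... | inj₂ (inj₂ refl) = there (here refl)
      M⊆ys : ∀ {v} → v ∈ M → v ∈ ys
      M⊆ys (here refl)                         = here refl
      M⊆ys (there (here refl))                 = there (there (here refl))
      M⊆ys (there (there (here refl)))         = there (here refl)
      M⊆ys (there (there (there (here refl)))) = there (there (here (sym ea≡ea′)))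
      partner : ∀ x → Outside x → Partner a x
      partner x out with outside⇒partner x out
      ... | inj₁ P         = P
      ... | inj₂ (_ , pc)  = retarget out pc ea≡ea′
      bound : Dec (∃ (Partner a)) → n ≤ 8
      bound (no none) = covered⇒≤8 ys covered (s≤s (s≤s (s≤s z≤n)))
        where
        covered : ∀ v → v ∈ L ++ ys
        covered v with trichotomy v
        ... | inj₁ v∈L        = ∈-++⁺ˡ v∈L
        ... | inj₂ (inj₁ v∈M) = ∈-++⁺ʳ L (M⊆ys v∈M)
        ... | inj₂ (inj₂ out) = ⊥-elim (none (v , partner v out))
      bound (yes (x , P@(out , pc)))
        with straddles out pc | coverPartnersOf a x P ys Y⊆ys (s≤s (s≤s z≤n))
      ... | p , q , p≢q , p∈L , q∈L , p∈Y , q∈Y | cs , cs≤ , P⊆cs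
        with thirdOf a a′ (e a) p≢q (Y⊆ys p p∈Y) (Y⊆ys q q∈Y)
      -- Besides the four vertices of `L`, one leftover element of the class and at most three
      -- partners.
      ...   | r , ys⊆ = covered⇒≤8 (r ∷ cs) covered (s≤s cs≤)
        where
        covered : ∀ v → v ∈ L ++ r ∷ cs
        covered v with trichotomy v
        ... | inj₁ v∈L        = ∈-++⁺ˡ v∈L
        ... | inj₂ (inj₂ o)   = ∈-++⁺ʳ L (there (P⊆cs v (partner v o)))
        ... | inj₂ (inj₁ v∈M) with ys⊆ v (M⊆ys v∈M)
        ...   | inj₁ v≡p        = ∈-++⁺ˡ (inL p∈L v≡p)
        ...   | inj₂ (inj₁ v≡q) = ∈-++⁺ˡ (inL q∈L v≡q)
        ...   | inj₂ (inj₂ v≡r) = ∈-++⁺ʳ L (here v≡r)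

    -- Without an outside partner the two elements of the class are the cover. With one, both
    -- elements lie in `L`, and only the at most two partners remain to be covered.
    halfCover : ∀ b → (∀ v → Fibre e b v → v ∈ b ∷ e b ∷ []) →
                ∃[ cs ] (length cs ≤ 2 × (∀ v → v ∈ b ∷ e b ∷ [] ⊎ Partner b v → v ∈ L ⊎ v ∈ cs))
    halfCover b Y⊆ys with any? (partner? b)
    ... | no none = b ∷ e b ∷ [] , ℕ.≤-refl , λ
      { v (inj₁ v∈) → inj₂ v∈ ; v (inj₂ P) → ⊥-elim (none (v , P)) }
    ... | yes (x , P@(out , pc)) with straddles out pc | coverPartnersOf b x P _ Y⊆ys ℕ.≤-refl
    ...   | p , q , p≢q , p∈L , q∈L , p∈Y , q∈Y | cs , cs≤ , P⊆cs = cs , cs≤ , λ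
      { v (inj₁ v∈) → inj₁ (pair p≢q (Y⊆ys p p∈Y) (Y⊆ys q q∈Y) p∈L q∈L v v∈) ; v (inj₂ P) → inj₂ (P⊆cs v P) }
      where
      pair : ∀ {p q y y′} → p ≢ q → p ∈ y ∷ y′ ∷ [] → q ∈ y ∷ y′ ∷ [] → p ∈ L → q ∈ L → ∀ v → v ∈ y ∷ y′ ∷ [] → v ∈ L
      pair p≢q (here refl)         (here refl)         p∈L q∈L = ⊥-elim (p≢q refl)
      pair p≢q (there (here refl)) (there (here refl)) p∈L q∈L = ⊥-elim (p≢q refl)
      pair p≢q (here refl) (there (here refl)) p∈L q∈L v (here eq)         = inL p∈L eq
      pair p≢q (here refl) (there (here refl)) p∈L q∈L v (there (here eq)) = inL q∈L eq
      pair p≢q (there (here refl)) (here refl) p∈L q∈L v (here eq)         = inL q∈L eq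
      pair p≢q (there (here refl)) (here refl) p∈L q∈L v (there (here eq)) = inL p∈L eq

    twoClasses : e a ≢ e a′ → n ≤ 8
    twoClasses ea≢ea′ with halfCover a Y⊆ | halfCover a′ Y′⊆
      where
      Y⊆ : ∀ v → Fibre e a v → v ∈ a ∷ e a ∷ []
      Y⊆ v eq with moved v
      ... | inj₁ ev≡v        = there (here (trans (sym ev≡v) eq))
      ... | inj₂ (inj₁ refl) = here refl
      ... | inj₂ (inj₂ refl) = ⊥-elim (ea≢ea′ (sym eq))
      Y′⊆ : ∀ v → Fibre e a′ v → v ∈ a′ ∷ e a′ ∷ []
      Y′⊆ v eq with moved v
      ... | inj₁ ev≡v        = there (here (trans (sym ev≡v) eq))
      ... | inj₂ (inj₁ refl) = ⊥-elim (ea≢ea′ eq)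
      ... | inj₂ (inj₂ refl) = here refl
    ... | cs , cs≤ , cover | cs′ , cs′≤ , cover′ = covered⇒≤8 (cs ++ cs′) covered
          (subst (_≤ 4) (sym (length-++ cs)) (ℕ.+-mono-≤ cs≤ cs′≤))
      where
      first : ∀ v → v ∈ a ∷ e a ∷ [] ⊎ Partner a v → v ∈ L ++ cs ++ cs′
      first v h = Sum.[ ∈-++⁺ˡ , ∈-++⁺ʳ L ∘ ∈-++⁺ˡ ] (cover v h)
      second : ∀ v → v ∈ a′ ∷ e a′ ∷ [] ⊎ Partner a′ v → v ∈ L ++ cs ++ cs′
      second v h = Sum.[ ∈-++⁺ˡ , ∈-++⁺ʳ L ∘ ∈-++⁺ʳ cs ] (cover′ v h)
      covered : ∀ v → v ∈ L ++ cs ++ cs′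
      covered v with trichotomy v
      ... | inj₁ v∈L = ∈-++⁺ˡ v∈L
      ... | inj₂ (inj₁ (here eq))                         = first v (inj₁ (here eq))
      ... | inj₂ (inj₁ (there (here eq)))                 = first v (inj₁ (there (here eq)))
      ... | inj₂ (inj₁ (there (there (here eq))))         = second v (inj₁ (here eq))
      ... | inj₂ (inj₁ (there (there (there (here eq))))) = second v (inj₁ (there (here eq)))
      ... | inj₂ (inj₂ out) with outside⇒partner v out
      ...   | inj₁ P = first v (inj₂ P)
      ...   | inj₂ P = second v (inj₂ P)

  coalescent⇒≤8 : n ≤ 8
  coalescent⇒≤8 with e a ≟ e a′
  ... | yes eq = oneClass eq
  ... | no neq = twoClasses neq

-- Enumeration of the small trees

degree : Graph n → Fin n → ℕ
degree G v = length (filterᵇ (adj G v) (allFin _))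

extendMaybe : (H : Graph n) (t : Tree m) (p : Fin m) (w : Fin n) → ⟦ t ⟧ ↪ H → Maybe (⟦ leaf t p ⟧ ↪ H)
extendMaybe H t p w E
  with all? (λ u → does (u ≟ p) Bool.≟ adj H w (_↪_.to E u)) ×-dec all? (λ u → ¬? (_↪_.to E u ≟ w))
... | yes (nbrs , fresh) = just (extend E p w fresh nbrs)
... | no _               = nothing

embeddings : (H : Graph n) (t : Tree m) → (Fin m → Fin n → Bool) → List (⟦ t ⟧ ↪ H)
embeddings H root       ok = map (rootAt H) (filterᵇ (ok zero) (allFin _))
embeddings H (leaf t p) ok =
  concatMap (λ E → mapMaybe (λ w → extendMaybe H t p w E) (filterᵇ (ok zero) (allFin _)))
    (embeddings H t (ok ∘ suc))

-- Isomorphisms preserve degrees, so restricting to images of equal degree prunes the search without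
-- loss. No refutation accompanies `nothing`; soundness rests only on the isomorphisms that are
-- returned.
findIso : (t : Tree n) (H : Graph n) → Maybe (⟦ t ⟧ ≅ H)
findIso t H = Maybe.map ↪⇒≅ (head (embeddings H t λ u w → degree ⟦ t ⟧ u ≡ᵇ degree H w))

Represented : List (Tree n) → Tree n → Set
Represented ts t = ∃[ t′ ] (t′ ∈ ts × ⟦ t ⟧ ≅ ⟦ t′ ⟧)

findRep : (ts : List (Tree n)) (t : Tree n) → Maybe (Represented ts t)
findRep []       t = nothing
findRep (t′ ∷ ts) t with findIso t ⟦ t′ ⟧
... | just φ  = just (t′ , here refl , φ)
... | nothing = Maybe.map (λ (t″ , t″∈ , φ) → t″ , there t″∈ , φ) (findRep ts t)

insert : Tree n → List (Tree n) → List (Tree n)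
insert t ts with findRep ts t
... | just _  = ts
... | nothing = t ∷ ts

dedup : List (Tree n) → List (Tree n)
dedup []       = []
dedup (t ∷ ts) = insert t (dedup ts)

reps : ∀ n → List (Tree n)
reps 0             = []
reps 1             = root ∷ []
reps (suc (suc n)) = dedup (concatMap (λ t → map (leaf t) (allFin _)) (reps (suc n)))

-- Search for partitions of the small trees

-- A partition into at least n - 2 classes is the kernel of a map fixing all but at most two vertices,
-- namely the one sending each vertex to the least element of its class.
redirect : Fin n → Fin n → (Fin n → Fin n) → Fin n → Fin n
redirect a b f v = if does (v ≟ a) then b else f v

-- For `b` equal to `a` the redirection is the identity, so `NoSingleMerge` also excludes the
-- partition into singletons. In `NoDoubleMerge`, `b′ ≢ a` expresses that the least element of a
-- class is not moved; `b` differs from `a′` by the order.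
NoSingleMerge NoDoubleMerge : Graph n → Set
NoSingleMerge G = ∀ a b → b Fin.≤ a → ¬ Coalescent G (redirect a b id)
NoDoubleMerge G = ∀ a a′ → a Fin.< a′ → ∀ b → b Fin.< a → ∀ b′ → b′ Fin.< a′ → b′ ≢ a →
                  ¬ Coalescent G (redirect a b (redirect a′ b′ id))

-- Classes are labelled by natural numbers, whose equality test is fast; rows holds, for each vertex,
-- the labels in its closed neighbourhood. Plausible is a necessary condition for being Coalescent,
-- cheap enough to discard almost all candidates before the full decision procedure is run.
Hits : List (List ℕ) → ℕ → ℕ → Set
Hits rows i j = All (Any λ x → x ≡ i ⊎ x ≡ j) rows

hits : List (List ℕ) → ℕ → ℕ → Bool
hits rows i j = all (any λ x → (x ≡ᵇ i) ∨ (x ≡ᵇ j)) rows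

hits? : ∀ rows i j → Dec (Hits rows i j)
hits? rows i j = map′
  (All.map (Any.map (Sum.map (ℕ.≡ᵇ⇒≡ _ _) (ℕ.≡ᵇ⇒≡ _ _) ∘ Equivalence.to T-∨) ∘ Any.any⁻ _ _) ∘ All.all⁺ _ rows)
  (All.all⁻ _ ∘ All.map (Any.any⁺ _ ∘ Any.map (Equivalence.from T-∨ ∘ Sum.map (ℕ.≡⇒≡ᵇ _ _) (ℕ.≡⇒≡ᵇ _ _))))
  (T? (hits rows i j))

Plausible : List (List ℕ) → List ℕ → Set
Plausible rows labels = All (λ i → ¬ Hits rows i i × Any (Hits rows i) labels) labels

plausible? : ∀ rows labels → Dec (Plausible rows labels)
plausible? rows labels = All.all? (λ i → ¬? (hits? rows i i) ×-dec Any.any? (hits? rows i) labels) labels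

closedNbrs : Graph n → Fin n → List (Fin n)
closedNbrs G v = v ∷ filter (Adj? G v) (allFin _)

nbrNames : Graph n → List (List ℕ)
nbrNames G = map (map toℕ ∘ closedNbrs G) (allFin _)

names : ∀ n → List ℕ
names n = map toℕ (allFin n)

-- A copy of `e` on natural numbers, with which the table of neighbourhoods of a graph is relabelled
-- for each candidate.
Labelling : (Fin n → Fin n) → Set
Labelling e = Σ (ℕ → ℕ) λ f → (∀ v → f (toℕ v) ≡ toℕ (e v))

idLabelling : Labelling {n} id
idLabelling = id , λ _ → refl

redirectLabelling : (a b : Fin n) {e : Fin n → Fin n} → Labelling e → Labelling (redirect a b e)
redirectLabelling a b {e} (f , impl) = f′ , impl′
  where
  f′ : ℕ → ℕ
  f′ v = if v ≡ᵇ toℕ a then toℕ b else f v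
  impl′ : ∀ v → f′ (toℕ v) ≡ toℕ (redirect a b e v)
  impl′ v with v ≟ a | toℕ v ≡ᵇ toℕ a in eq
  ... | yes _    | true  = refl
  ... | no  _    | false = impl v
  ... | yes refl | false = ⊥-elim (subst T eq (ℕ.≡⇒≡ᵇ (toℕ v) _ refl))
  ... | no v≢a   | true  = ⊥-elim (v≢a (toℕ-injective (ℕ.≡ᵇ⇒≡ _ _ (subst T (sym eq) _))))

module _ (G : Graph n) {e : Fin n → Fin n} (labelling : Labelling e) where

  private
    open Σ labelling renaming (proj₁ to f; proj₂ to impl)

    label : Fin n → ℕ
    label v = f (toℕ v)

    label-cong : ∀ {u v} → e u ≡ e v → label u ≡ label v
    label-cong eq = trans (impl _) (trans (cong toℕ eq) (sym (impl _)))

    label-injective : ∀ {u v} → label u ≡ label v → e u ≡ e v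
    label-injective eq = toℕ-injective (trans (sym (impl _)) (trans eq (impl _)))

    hits⁺ : ∀ v w → Dominating G (Fibre e v ∪ Fibre e w) → Hits (map (map f) (nbrNames G)) (label v) (label w)
    hits⁺ v w dom = All.map⁺ (All.map⁺ (All.tabulate λ {x} _ → Any.map⁺ (Any.map⁺ (row x (dom x)))))
      where
      row : ∀ x → (Fibre e v ∪ Fibre e w) x ⊎ (∃[ u ] ((Fibre e v ∪ Fibre e w) u × Adj G x u)) →
            Any (λ u → label u ≡ label v ⊎ label u ≡ label w) (closedNbrs G x)
      row x (inj₁ x∈)            = here (Sum.map label-cong label-cong x∈)
      row x (inj₂ (u , u∈ , xu)) =
        there (lose (∈-filter⁺ (Adj? G x) (∈-allFin u) xu) (Sum.map label-cong label-cong u∈))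

    hits⁻ : ∀ v → Hits (map (map f) (nbrNames G)) (label v) (label v) → Dominating G (Fibre e v)
    hits⁻ v hit x with Any.map⁻ (Any.map⁻ (All.lookup (All.map⁻ (All.map⁻ hit)) (∈-allFin x)))
    ... | here x∈ = inj₁ (label-injective (Sum.[ id , id ] x∈))
    ... | there later with find later
    ...   | u , u∈ , eq = inj₂ (u , label-injective (Sum.[ id , id ] eq) , proj₂ (∈-filter⁻ (Adj? G x) {xs = allFin n} u∈))

  coalescent⇒plausible : Coalescent G e → Plausible (map (map f) (nbrNames G)) (map f (names n))
  coalescent⇒plausible coalescent = All.map⁺ (All.map⁺ (All.tabulate λ {v} _ → ok v (coalescent v)))
    where
    ok : ∀ v → ∃[ w ] PerfectCoalition G (Fibre e v) (Fibre e w) →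
         ¬ Hits _ (label v) (label v) × Any (Hits _ (label v)) (map f (names n))
    ok v (w , _ , ¬dom , _ , _ , _ , dom , _) =
      ¬dom ∘ hits⁻ v , Any.map⁺ (Any.map⁺ (lose (∈-allFin w) (hits⁺ v w dom)))

coalescent? : (G : Graph n) → ∀ e → Dec (Coalescent G e)
coalescent? G e = all? λ v → any? λ w → perfectCoalition? G (λ u → e u ≟ e v) (λ u → e u ≟ e w)

module _ (G : Graph n) where

  private
    -- The table of closed neighbourhoods is an argument so that it is evaluated only once.
    refute : ∀ {ns e} → ns ≡ nbrNames G → Labelling e → Dec (¬ Coalescent G e)
    refute {ns} {e} refl l with plausible? (map (map (proj₁ l)) ns) (map (proj₁ l) (names n))
    ... | no ¬p = yes (¬p ∘ coalescent⇒plausible G l)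
    ... | yes _ = ¬? (coalescent? G e)

    noSingle : ∀ ns → ns ≡ nbrNames G → Dec (NoSingleMerge G)
    noSingle ns eq = all? λ a → all? λ b → (b Fin.≤? a) →-dec
      refute eq (redirectLabelling a b idLabelling)

    noDouble : ∀ ns → ns ≡ nbrNames G → Dec (NoDoubleMerge G)
    noDouble ns eq = all? λ a → all? λ a′ → (a Fin.<? a′) →-dec
      (all? λ b → (b Fin.<? a) →-dec
      (all? λ b′ → (b′ Fin.<? a′) →-dec (¬? (b′ ≟ a) →-dec
      refute eq (redirectLabelling a b (redirectLabelling a′ b′ idLabelling)))))

  noSingleMerge? : Dec (NoSingleMerge G)
  noSingleMerge? = noSingle (nbrNames G) refl

  noDoubleMerge? : Dec (NoDoubleMerge G)
  noDoubleMerge? = noDouble (nbrNames G) refl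

-- Verdicts on the small trees

Listed : Graph n → Set
Listed G = (G ≅ Path 5) ⊎ (G ≅ Path 6) ⊎ (G ≅ Path 7) ⊎ (G ≅ R)

-- The path on four vertices needs its own case: its singletons form a coalition partition, the two
-- ends being partners and the two inner vertices likewise. A listed tree does have a double merge,
-- so for it only single merges are excluded.
Verdict : Graph n → Set
Verdict G = (G ≅ Path 4) ⊎ (NoSingleMerge G × (Listed G ⊎ NoDoubleMerge G))

findIso′ : (t : Tree n) (H : Graph m) → Maybe (⟦ t ⟧ ≅ H)
findIso′ {n} {m} t H with n ℕ.≟ m
... | yes refl = findIso t H
... | no  _    = nothing

listed : (t : Tree n) → Maybe (Listed ⟦ t ⟧)
listed t = Maybe.map inj₁ (findIso′ t (Path 5))
  <∣> Maybe.map (inj₂ ∘ inj₁) (findIso′ t (Path 6))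
  <∣> Maybe.map (inj₂ ∘ inj₂ ∘ inj₁) (findIso′ t (Path 7))
  <∣> Maybe.map (inj₂ ∘ inj₂ ∘ inj₂) (findIso′ t R)

verdict : (t : Tree n) → Maybe (Verdict ⟦ t ⟧)
verdict t with findIso′ t (Path 4) | noSingleMerge? ⟦ t ⟧ | listed t | noDoubleMerge? ⟦ t ⟧
... | just φ | _ | _ | _ = just (inj₁ φ)
... | nothing | yes none | just l | _ = just (inj₂ (none , inj₁ l))
... | nothing | yes none | nothing | yes none₂ = just (inj₂ (none , inj₂ none₂))
... | nothing | yes none | nothing | no _ = nothing
... | nothing | no _ | _ | _ = nothing

verdicts : (ts : List (Tree n)) → Maybe (All (Verdict ∘ ⟦_⟧) ts)
verdicts []       = just []
verdicts (t ∷ ts) with verdict t | verdicts ts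
... | just v  | just vs = just (v ∷ vs)
... | just _  | nothing = nothing
... | nothing | _       = nothing

-- With `refl` as second argument, type checking runs the search and reads off only whether it
-- succeeded.
extract : {A : Set} (x : Maybe A) → is-just x ≡ true → A
extract (just a) _ = a

-- Completeness of the enumeration

↪-trans : {G : Graph k} {H : Graph m} {K : Graph n} → G ↪ H → H ↪ K → G ↪ K
↪-trans E F = record
  { to = F.to ∘ E.to ; injective = E.injective ∘ F.injective
  ; preserves = λ u v → trans (E.preserves u v) (F.preserves _ _) }
  where
  module E = _↪_ E
  module F = _↪_ F

leaf-cong : (t t′ : Tree n) (p : Fin n) (φ : ⟦ t ⟧ ≅ ⟦ t′ ⟧) → ⟦ leaf t p ⟧ ≅ ⟦ leaf t′ (Inverse.to (proj₁ φ) p) ⟧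
leaf-cong t t′ p φ = ↪⇒≅ {H = ⟦ leaf t′ (to p) ⟧}
  (extend (↪-trans {H = ⟦ t′ ⟧} {K = ⟦ leaf t′ (to p) ⟧} E (weaken t′ (to p))) p zero (λ _ ()) nbrs)
  where
  E = ≅⇒↪ ⟦ t ⟧ ⟦ t′ ⟧ φ
  open _↪_ E using (to; injective)
  nbrs : ∀ u → does (u ≟ p) ≡ does (to u ≟ to p)
  nbrs u with u ≟ p
  ... | yes refl = sym (dec-true (to p ≟ to p) refl)
  ... | no u≢p   = sym (dec-false (to u ≟ to p) (u≢p ∘ injective))

dedup-represents : {t : Tree n} (ts : List (Tree n)) → t ∈ ts → Represented (dedup ts) t
dedup-represents (s ∷ ts) (here refl) with findRep (dedup ts) s
... | just found = found
... | nothing    = s , here refl , ≅-refl ⟦ s ⟧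
dedup-represents (s ∷ ts) (there t∈) with findRep (dedup ts) s | dedup-represents ts t∈
... | just _  | found           = found
... | nothing | t′ , t′∈ , φ = t′ , there t′∈ , φ

-- The smaller tree is replaced by its representative and the attachment point is carried along the
-- isomorphism; `reps` tries every attachment point.
reps-complete : (t : Tree n) → Represented (reps n) t
reps-complete root = root , here refl , ≅-refl ⟦ root ⟧
reps-complete {suc zero} (leaf t ())
reps-complete {suc (suc n)} (leaf t p) with reps-complete t
... | t′ , t′∈ , φ
  with dedup-represents (concatMap (λ t → map (leaf t) (allFin _)) (reps (suc n)))
         (∈-concatMap⁺ _ (lose t′∈ (∈-map⁺ (leaf t′) (∈-allFin (Inverse.to (proj₁ φ) p)))))
...   | t″ , t″∈ , ψ = t″ , t″∈ ,
      ≅-trans ⟦ leaf t p ⟧ ⟦ leaf t′ (Inverse.to (proj₁ φ) p) ⟧ ⟦ t″ ⟧ (leaf-cong t t′ p φ) ψ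

-- From partitions to maps moving at most two vertices

-- Least representatives give `e v ≤ v`, which yields the order constraints that shrink the search.
leastPreimage : (c : Fin n → Fin k) (i : Fin k) → ∃[ v ] c v ≡ i → ∃[ v ] (c v ≡ i × (∀ u → c u ≡ i → v Fin.≤ u))
leastPreimage {suc n} c i (v , cv≡i) with c zero ≟ i
... | yes c0≡i = zero , c0≡i , λ _ _ → z≤n
leastPreimage {suc n} c i (zero  , c0≡i) | no c0≢i = ⊥-elim (c0≢i c0≡i)
leastPreimage {suc n} c i (suc v , cv≡i) | no c0≢i with leastPreimage (c ∘ suc) i (v , cv≡i)
... | w , cw≡i , least = suc w , cw≡i , λ { zero c0≡i → ⊥-elim (c0≢i c0≡i) ; (suc u) cu≡i → s≤s (least u cu≡i) }

data Merging (G : Graph n) (k : ℕ) : Set where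
  single : ∀ a b → b Fin.≤ a → Coalescent G (redirect a b id) → Merging G k
  double : 2 + k ≤ n → ∀ a a′ → a Fin.< a′ → ∀ b → b Fin.< a → ∀ b′ → b′ Fin.< a′ → b′ ≢ a →
           Coalescent G (redirect a b (redirect a′ b′ id)) → Merging G k

module _ (G : Graph n) (two : TwoLeaves G) (c : Fin n → Fin k) (ok : IsPRCPartition G k c) where

  private
    r : Fin k → Fin n
    r i = proj₁ (leastPreimage c i (proj₁ ok i))

    c∘r : ∀ i → c (r i) ≡ i
    c∘r i = proj₁ (proj₂ (leastPreimage c i (proj₁ ok i)))

    e : Fin n → Fin n
    e v = r (c v)

    e≤ : ∀ v → e v Fin.≤ v
    e≤ v = proj₂ (proj₂ (leastPreimage c (c v) (proj₁ ok (c v)))) v refl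

    r-injective : ∀ {i j} → r i ≡ r j → i ≡ j
    r-injective {i} {j} eq = trans (sym (c∘r i)) (trans (cong c eq) (c∘r j))

    Moved : Fin n → Set
    Moved v = e v ≢ v

    moved? : Decidable Moved
    moved? v = ¬? (e v ≟ v)

    fixed : ∀ {v} → ¬ Moved v → e v ≡ v
    fixed {v} = decidable-stable (e v ≟ v)

    r≢moved : ∀ {v} → Moved v → ∀ i → r i ≢ v
    r≢moved moved i refl = moved (cong r (c∘r i))

    e≢moved : ∀ {u v} → Moved v → e u ≢ v
    e≢moved moved eq = r≢moved moved _ eq

    e< : ∀ {v} → Moved v → e v Fin.< v
    e< {v} moved = Fin.≤∧≢⇒< (e≤ v) moved

    -- The `k` representatives are fixed by `e`, so moved vertices come on top of them.
    twoMoved⇒≤ : ∀ {u v} → Moved u → Moved v → u ≢ v → 2 + k ≤ n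
    twoMoved⇒≤ {u} {v} mu mv u≢v = injective⇒≤ {f = v Vector.∷ u Vector.∷ r}
      (∷-injective (∷-injective r-injective (r≢moved mu)) λ { zero → u≢v ; (suc i) → r≢moved mv i })

    threeMoved⇒≤ : ∀ {u v w} → Moved u → Moved v → Moved w → u ≢ v → u ≢ w → v ≢ w → 3 + k ≤ n
    threeMoved⇒≤ {u} {v} {w} mu mv mw u≢v u≢w v≢w = injective⇒≤ {f = w Vector.∷ v Vector.∷ u Vector.∷ r}
      (∷-injective (∷-injective (∷-injective r-injective (r≢moved mu)) λ { zero → u≢v ; (suc i) → r≢moved mv i })
        λ { zero → v≢w ; (suc zero) → u≢w ; (suc (suc i)) → r≢moved mw i })

    -- The only element of such a class would have to lie in both `{l, s}` and `{l′, s′}`, which are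
    -- disjoint.
    noDominatingVertex : ∀ i → ¬ (Dominating G (Class c i) × (∀ u v → c u ≡ i → c v ≡ i → u ≡ v))
    noDominatingVertex i (dom , one) with near leaf₁ | near leaf₂
      where
      open TwoLeaves two
      near : ∀ {p q} → LeafOf G p q → c p ≡ i ⊎ c q ≡ i
      near {p} (_ , only) with dom p
      ... | inj₁ p∈            = inj₁ p∈
      ... | inj₂ (x , x∈ , px) = inj₂ (subst (λ y → c y ≡ i) (only x px) x∈)
    ... | inj₁ l∈ | inj₁ l′∈ = TwoLeaves.l≢l′ two (one _ _ l∈ l′∈)
    ... | inj₁ l∈ | inj₂ s′∈ = TwoLeaves.l≢s′ two (one _ _ l∈ s′∈)
    ... | inj₂ s∈ | inj₁ l′∈ = TwoLeaves.s≢l′ two (one _ _ s∈ l′∈)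
    ... | inj₂ s∈ | inj₂ s′∈ = TwoLeaves.s≢s′ two (one _ _ s∈ s′∈)

    coalescent : ∀ {f} → (∀ v → e v ≡ f v) → Coalescent G f
    coalescent {f} e≗f v with proj₂ ok (c v)
    ... | inj₁ dominating = ⊥-elim (noDominatingVertex (c v) dominating)
    ... | inj₂ (j , pc) = r j , perfectCoalition⁺ G G (≅-refl G) (same refl) (same (c∘r j)) pc
      where
      same : ∀ {w i} → c w ≡ i → (∀ {u} → c u ≡ i → f u ≡ f w) × (∀ {u} → f u ≡ f w → c u ≡ i)
      same {w} refl =
        (λ {u} eq → trans (sym (e≗f u)) (trans (cong r eq) (e≗f w))) ,
        (λ {u} eq → r-injective (trans (e≗f u) (trans eq (sym (e≗f w)))))

    singleMerging : ∀ a → (∀ v → v ≢ a → e v ≡ v) → Merging G k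
    singleMerging a others = single a (e a) (e≤ a) (coalescent agree)
      where
      agree : ∀ v → e v ≡ redirect a (e a) id v
      agree v with v ≟ a
      ... | yes refl = refl
      ... | no v≢a   = others v v≢a

    doubleMerging : ∀ a a′ → Moved a → Moved a′ → a Fin.< a′ →
                    (∀ v → v ≢ a → v ≢ a′ → e v ≡ v) → Merging G k
    doubleMerging a a′ ma ma′ a<a′ others =
      double (twoMoved⇒≤ ma ma′ (Fin.<⇒≢ a<a′)) a a′ a<a′ (e a) (e< ma) (e a′) (e< ma′) (e≢moved ma)
        (coalescent agree)
      where
      agree : ∀ v → e v ≡ redirect a (e a) (redirect a′ (e a′) id) v
      agree v with v ≟ a
      ... | yes refl = refl
      ... | no v≢a with v ≟ a′
      ...   | yes refl = refl
      ...   | no v≢a′  = others v v≢a v≢a′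

  merging : n ≤ 2 + k → Merging G k
  merging n≤2+k with any? moved?
  -- When nothing is moved, any vertex can play `a`, redirected to itself.
  ... | no none = singleMerging (TwoLeaves.l two) λ v _ → fixed λ mv → none (v , mv)
  ... | yes (a , ma) with any? (λ v → moved? v ×-dec ¬? (v ≟ a))
  ...   | no none = singleMerging a λ v v≢a → fixed λ mv → none (v , mv , v≢a)
  ...   | yes (a′ , ma′ , a′≢a) = pair (Fin.<-cmp a a′)
    where
    others : ∀ v → v ≢ a → v ≢ a′ → e v ≡ v
    others v v≢a v≢a′ = fixed λ mv → ℕ.<⇒≱ (threeMoved⇒≤ ma ma′ mv (a′≢a ∘ sym) (v≢a ∘ sym) (v≢a′ ∘ sym)) n≤2+k
    pair : _ → Merging G k
    pair (tri< a<a′ _ _)   = doubleMerging a a′ ma ma′ a<a′ others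
    pair (tri≈ _ refl _)   = ⊥-elim (a′≢a refl)
    pair (tri> _ _ a′<a)   = doubleMerging a′ a ma′ ma a′<a λ v v≢a′ v≢a → others v v≢a v≢a′

merging⇒≤8 : (t : Tree n) → TwoLeaves ⟦ t ⟧ → Merging ⟦ t ⟧ k → n ≤ 8
merging⇒≤8 t two (single a b _ coalescent) = coalescent⇒≤8 t two (redirect a b id) a a moved coalescent
  where
  moved : ∀ v → redirect a b id v ≡ v ⊎ v ≡ a ⊎ v ≡ a
  moved v with v ≟ a
  ... | yes eq = inj₂ (inj₁ eq)
  ... | no _   = inj₁ refl
merging⇒≤8 t two (double _ a a′ a<a′ b b<a b′ b′<a′ b′≢a coalescent) =
  coalescent⇒≤8 t two f a a′ moved coalescent
  where
  f = redirect a b (redirect a′ b′ id)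
  moved : ∀ v → f v ≡ v ⊎ v ≡ a ⊎ v ≡ a′
  moved v with v ≟ a
  ... | yes eq = inj₂ (inj₁ eq)
  ... | no v≢a with v ≟ a′
  ...   | yes eq = inj₂ (inj₂ eq)
  ...   | no v≢a′ = inj₁ refl

-- Classification of the trees with at least n - 2 classes

listed-resp-≅ : (G H : Graph n) → G ≅ H → Listed H → Listed G
listed-resp-≅ G H φ = Sum.map (tr (Path 5)) (Sum.map (tr (Path 6)) (Sum.map (tr (Path 7)) (tr R)))
  where
  tr : ∀ {m} (K : Graph m) → H ≅ K → G ≅ K
  tr K = ≅-trans G H K φ

verdictsUpTo8 : (d : Fin 6) → All (Verdict ∘ ⟦_⟧) (reps (3 + toℕ d))
verdictsUpTo8 0F = extract (verdicts (reps 3)) refl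
verdictsUpTo8 1F = extract (verdicts (reps 4)) refl
verdictsUpTo8 2F = extract (verdicts (reps 5)) refl
verdictsUpTo8 3F = extract (verdicts (reps 6)) refl
verdictsUpTo8 4F = extract (verdicts (reps 7)) refl
verdictsUpTo8 5F = extract (verdicts (reps 8)) refl

allVerdicts : ∀ n → 2 < n → n ≤ 8 → All (Verdict ∘ ⟦_⟧) (reps n)
allVerdicts n 2<n n≤8 = subst (λ m → All (Verdict ∘ ⟦_⟧) (reps m))
  (trans (cong (3 +_) (Fin.toℕ-fromℕ< n∸3<6)) (ℕ.m+[n∸m]≡n 2<n)) (verdictsUpTo8 (Fin.fromℕ< n∸3<6))
  where
  n∸3<6 : n ∸ 3 < 6
  n∸3<6 = s≤s (ℕ.∸-monoˡ-≤ 3 n≤8)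

tree-classification : (t : Tree n) → 2 < n → ¬ (⟦ t ⟧ ≅ Path 4) → HasPRCPartition ⟦ t ⟧ k → n ≤ 2 + k →
                      2 + k ≤ n × Listed ⟦ t ⟧
tree-classification {n} {k} t 2<n t≇P₄ has n≤2+k with reps-complete t
... | t′ , t′∈ , φ = judge (All.lookup (allVerdicts n 2<n (uncurry (merging⇒≤8 t) (twoMerging t has))) t′∈)
  where
  twoMerging : ∀ s → HasPRCPartition ⟦ s ⟧ k → TwoLeaves ⟦ s ⟧ × Merging ⟦ s ⟧ k
  twoMerging s has@(c , ok) with star⊎twoLeaves s
  ... | inj₁ star = ⊥-elim (starHasNoPRCPartition ⟦ s ⟧ 2<n star has)
  ... | inj₂ two  = two , merging ⟦ s ⟧ two c ok n≤2+k
  judge : Verdict ⟦ t′ ⟧ → 2 + k ≤ n × Listed ⟦ t ⟧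
  judge (inj₁ t′≅P₄) = ⊥-elim (t≇P₄ (≅-trans ⟦ t ⟧ ⟦ t′ ⟧ (Path 4) φ t′≅P₄))
  judge (inj₂ (noSingle , verdict))
    -- The partition is carried to `t′` and normalised there afresh: the order constraints in
    -- `Merging` depend on the numbering of the vertices, which `φ` need not respect.
    with proj₂ (twoMerging t′ (hasPRCPartition⁺ ⟦ t ⟧ ⟦ t′ ⟧ φ has))
  ... | single a b b≤a coalescent = ⊥-elim (noSingle a b b≤a coalescent)
  ... | double 2+k≤n a a′ a<a′ b b<a b′ b′<a′ b′≢a coalescent with verdict
  ...   | inj₁ l = 2+k≤n , listed-resp-≅ ⟦ t ⟧ ⟦ t′ ⟧ φ l
  ...   | inj₂ noDouble = ⊥-elim (noDouble a a′ a<a′ b b<a b′ b′<a′ b′≢a coalescent)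

-- Partitions attaining n - 2, and the conclusion

colouring : (G : Graph n) (c : Vec (Fin k) n) →
            does (isPRCPartition? G k (Vec.lookup c)) ≡ true → HasPRCPartition G k
colouring G c ok = Vec.lookup c , does⇒ (isPRCPartition? G _ (Vec.lookup c)) ok

-- Class 0 is a partner of both 1 and 2.
path₅ : HasPRCPartition (Path 5) 3
path₅ = colouring (Path 5) (# 0 ∷ # 0 ∷ # 1 ∷ # 1 ∷ # 2 ∷ []) refl

-- The coalitions are 0 with 2 and 1 with 3.
path₆ : HasPRCPartition (Path 6) 4
path₆ = colouring (Path 6) (# 0 ∷ # 1 ∷ # 1 ∷ # 0 ∷ # 2 ∷ # 3 ∷ []) refl

-- Class 0 pairs with 4, and class 1 with both 2 and 3.
path₇ : HasPRCPartition (Path 7) 5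
path₇ = colouring (Path 7) (# 0 ∷ # 1 ∷ # 2 ∷ # 0 ∷ # 3 ∷ # 1 ∷ # 4 ∷ []) refl

-- The coalitions are 0 with 2 and 1 with 3.
graphR : HasPRCPartition R 4
graphR = colouring R (# 0 ∷ # 1 ∷ # 0 ∷ # 2 ∷ # 1 ∷ # 3 ∷ []) refl

≅⇒≡ : (G : Graph m) (H : Graph n) → G ≅ H → m ≡ n
≅⇒≡ G H φ = ℕ.≤-antisym
  (injective⇒≤ (_↪_.injective (≅⇒↪ G H φ)))
  (injective⇒≤ (_↪_.injective (≅⇒↪ H G (≅-sym G H φ))))

listed⇒hasPRCPartition : (G : Graph n) → Listed G → HasPRCPartition G (n ∸ 2)
listed⇒hasPRCPartition {n} G =
  Sum.[ from (Path 5) path₅ , Sum.[ from (Path 6) path₆ , Sum.[ from (Path 7) path₇ , from R graphR ] ] ]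
  where
  from : ∀ {m} (H : Graph m) → HasPRCPartition H (m ∸ 2) → G ≅ H → HasPRCPartition G (n ∸ 2)
  from H has φ with ≅⇒≡ G H φ
  ... | refl = hasPRCPartition⁺ H G (≅-sym G H φ) has

theorem4p8 : (n : ℕ) (T : Graph n) → IsTree T → 2 < n → ¬ (T ≅ Path 4) →
    ∃[ p ] (PRC T p × p ≤ n ∸ 2 ×
    (p ≡ n ∸ 2 ⇔ ((T ≅ Path 5) ⊎ (T ≅ Path 6) ⊎ (T ≅ Path 7) ⊎ (T ≅ R))))
theorem4p8 n T (connected , acyclic) 2<n T≇P₄ with isTree⇒≅ {G = T} connected acyclic (Fin.fromℕ< 2<n)
... | t , φ = conclude (∃PRC T)
  where
  classify : ∀ {k} → HasPRCPartition T k → n ≤ 2 + k → 2 + k ≤ n × Listed T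
  classify has n≤2+k
    with tree-classification t 2<n
           (λ ψ → T≇P₄ (≅-trans T ⟦ t ⟧ (Path 4) T≅t ψ)) (hasPRCPartition⁺ T ⟦ t ⟧ T≅t has) n≤2+k
    where T≅t = ≅-sym ⟦ t ⟧ T φ
  ... | 2+k≤n , l = 2+k≤n , listed-resp-≅ T ⟦ t ⟧ (≅-sym ⟦ t ⟧ T φ) l
  bound : ∀ {k} → HasPRCPartition T k → k ≤ n ∸ 2
  bound {k} has with n ≤? 2 + k
  ... | yes n≤2+k = ℕ.∸-monoˡ-≤ 2 (proj₁ (classify has n≤2+k))
  ... | no  n≰2+k = ℕ.∸-monoˡ-≤ 2 (ℕ.<⇒≤ (ℕ.≰⇒> n≰2+k))
  conclude : ∃[ p ] PRC T p → ∃[ p ] (PRC T p × p ≤ n ∸ 2 × (p ≡ n ∸ 2 ⇔ Listed T))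
  conclude (p , prc@(inj₁ (has , maximal))) = p , prc , bound has , mk⇔
    (λ p≡ → proj₂ (classify has (ℕ.≤-trans (ℕ.m≤n+m∸n n 2) (ℕ.≤-reflexive (cong (2 +_) (sym p≡))))))
    (λ l → ℕ.≤-antisym (bound has) (maximal _ (listed⇒hasPRCPartition T l)))
  -- Both directions are vacuous: `n ∸ 2` is positive, and a listed tree has a partition.
  conclude (p , prc@(inj₂ (refl , none))) = p , prc , z≤n , mk⇔
    (λ 0≡ → ⊥-elim (ℕ.m>n⇒m∸n≢0 2<n (sym 0≡)))
    (λ l → ⊥-elim (none _ (listed⇒hasPRCPartition T l)))
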